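{- Let $f$ be a positive integer-valued function on the positive integers satisfying $f(n)=o(n)$, and assume that $n$ is sufficiently large (in terms of $f$). If $G$ is an $n$-vertex $K_3$-free graph with minimum degree at least $\frac{1}{3}n-f(n)$ and chromatic number at least $10^{391}$, then $G$ admits a partition $V(G)=I_1\cup I_2\cup A$ such that $I_1,I_2$ are independent sets, $|I_1|\geq \frac{2}{3}n-9f(n)$, $|I_2|\geq\frac{n}{3}-24f(n)$, and the induced subgraph $G[A]$ admits a graph homomorphism to the Kneser graph $KG(\frac{1}{3}n-44f(n),97f(n))$.
   Context: All graphs are finite and simple. For positive integers $m,k$, the Kneser graph $KG(m,k)$ has as vertex set the collection of all $m$-element subsets of $[2m+k]=\{1,\dots,2m+k\}$, two vertices being adjacent if and only if the corresponding subsets are disjoint (this is the graph often denoted $KG(2m+k,m)$). A graph homomorphism $F\to F'$ is a vertex map sending every edge of $F$ to an edge of $F'$. Rounding convention: quantities such as $\frac13 n-44f(n)$, $\frac23n-9f(n)$, $\frac n3-24f(n)$ used as integer parameters or cardinalities are understood to be rounded to an integer by a floor or ceiling compatible with the surrounding statement (for instance, the first Kneser parameter may be taken to be $\lceil\frac13 n\rceil-44f(n)$). -}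

module Defs where

open import Data.Fin using (Fin)
open import Data.Fin.Subset using (Subset; _∈_; _∩_; _∪_; ⊤; Empty; ∣_∣)
open import Data.Fin.Subset.Properties using (nonempty?; ∩-comm; ∩-idem; Empty-unique; ∣⊥∣≡0)
open import Data.Integer using (+_)
open import Data.Nat using (ℕ; NonZero; _+_; _*_; _≤_; ≢-nonZero⁻¹)
open import Data.Nat.DivMod using (_/_)
open import Data.Product using (Σ; Σ-syntax; ∃-syntax; _×_; proj₁; proj₂; _,_)
open import Data.Rational.Unnormalised as ℚ using (ℚᵘ; 0ℚᵘ)
open import Data.Vec using (tabulate)
open import Level using (0ℓ)
open import Relation.Binary using (Rel; Symmetric; Decidable)
open import Relation.Binary.PropositionalEquality using (_≡_; _≢_; sym; trans; cong; subst)
open import Relation.Nullary using (¬_; does; ¬?)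

fromℕ : ℕ → ℚᵘ
fromℕ n = + n ℚ./ 1

-- Real ε may be replaced by rational ε, since every positive real has a
-- smaller positive rational.
_∈o_ : (f g : ℕ → ℕ) → Set
f ∈o g = ∀ (ε : ℚᵘ) → 0ℚᵘ ℚ.< ε →
  ∃[ N ] (∀ n → N ≤ n → fromℕ (f n) ℚ.≤ ε ℚ.* fromℕ (g n))

⌈_/3⌉ : ℕ → ℕ
⌈ n /3⌉ = (n + 2) / 3

-- Adjacency is required to be decidable, as it classically always is; this
-- is what makes degrees of finite graphs computable numbers.
record SimpleGraph (V : Set) : Set₁ where
  field
    Adj    : Rel V 0ℓ
    adj?   : Decidable Adj
    symm   : Symmetric Adj
    irrefl : ∀ {v} → ¬ Adj v v

open SimpleGraph public

record Hom {V W : Set} (G : SimpleGraph V) (H : SimpleGraph W) : Set where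
  field
    map      : V → W
    map-edge : ∀ {u v} → Adj G u v → Adj H (map u) (map v)

TriangleFree : ∀ {V} → SimpleGraph V → Set
TriangleFree G = ∀ u v w → ¬ (Adj G u v × Adj G v w × Adj G u w)

Colorable : ∀ {V} → SimpleGraph V → ℕ → Set
Colorable {V} G k = Σ[ c ∈ (V → Fin k) ] (∀ u v → Adj G u v → c u ≢ c v)

IsChromaticNumber : ∀ {V} → SimpleGraph V → ℕ → Set
IsChromaticNumber G χ = Colorable G χ × (∀ k → Colorable G k → χ ≤ k)

neighbours : ∀ {n} → SimpleGraph (Fin n) → Fin n → Subset n
neighbours G v = tabulate (λ u → does (adj? G v u))

degree : ∀ {n} → SimpleGraph (Fin n) → Fin n → ℕ
degree G v = ∣ neighbours G v ∣

MinDegreeAtLeast : ∀ {n} → SimpleGraph (Fin n) → ℚᵘ → Set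
MinDegreeAtLeast G d = ∀ v → d ℚ.≤ fromℕ (degree G v)

Independent : ∀ {n} → SimpleGraph (Fin n) → Subset n → Set
Independent G I = ∀ u v → u ∈ I → v ∈ I → ¬ Adj G u v

IsPartition : ∀ {n} → Subset n → Subset n → Subset n → Set
IsPartition P Q R =
  (P ∪ Q ∪ R ≡ ⊤) × Empty (P ∩ Q) × Empty (P ∩ R) × Empty (Q ∩ R)

_[_] : ∀ {n} → SimpleGraph (Fin n) → (A : Subset n) → SimpleGraph (Σ[ v ∈ Fin n ] v ∈ A)
G [ A ] = record
  { Adj    = λ u v → Adj G (proj₁ u) (proj₁ v)
  ; adj?   = λ u v → adj? G (proj₁ u) (proj₁ v)
  ; symm   = symm G
  ; irrefl = irrefl G
  }

KneserVertex : ℕ → ℕ → Set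
KneserVertex m k = Σ[ S ∈ Subset (2 * m + k) ] ∣ S ∣ ≡ m

-- The positivity of m is used for irreflexivity: the empty set is disjoint
-- from itself.
KG : ∀ m k → .{{NonZero m}} → .{{NonZero k}} → SimpleGraph (KneserVertex m k)
KG m k = record
  { Adj    = λ S T → Empty (proj₁ S ∩ proj₁ T)
  ; adj?   = λ S T → ¬? (nonempty? (proj₁ S ∩ proj₁ T))
  ; symm   = λ {S} {T} → subst Empty (∩-comm (proj₁ S) (proj₁ T))
  ; irrefl = λ {S} S∩S-empty → ≢-nonZero⁻¹ m
      (trans (sym (proj₂ S))
      (trans (cong ∣_∣ (Empty-unique (subst Empty (∩-idem (proj₁ S)) S∩S-empty)))
             (∣⊥∣≡0 (2 * m + k))))
  }

{-# OPTIONS --safe #-}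

-- Let d be n/3 - f(n), a lower bound for all degrees.  Colour the vertices by
-- boundedly many statistics of their neighbourhoods: as χ is large, some edge
-- yz is monochromatic, so y and z are indistinguishable for these statistics.
--
-- First, this yields a vertex of degree at least 0.56 n.  For an edge e = yz
-- put u = 1_{N(y)} - 1_{N(z)}, with both neighbourhoods cut down to size d.
-- Choose edges e₁, e₂, ... successively, the statistics being the inner
-- products with the earlier u's, so that the u's are almost orthogonal.  As
-- N(y) and N(z) are independent, uᵀAu is minus twice the number of edges
-- between them, and this number is quadratic in n if all degrees are below
-- 0.56 n (there is no room outside N(y) ∪ N(z) for the edges that leave it).
-- Hence Σ (10(2A - 1) + Σᵢ uᵢuᵢᵀ)², a sum of n² squares which is 100 n² at the
-- start, drops by at least n²/2 with every edge: at most 200 edges exist.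
--
-- Secondly, let b have large degree and P = {v : N(v) ∩ N(b) = ∅}, which is
-- an independent set containing N(b).  Each v outside P has at least
-- 2d + |P| - n neighbours in P.  Those with more than n - 2d of them share a
-- neighbour in P with every other vertex outside P, so they form an
-- independent set I₂ with all neighbours in P; A consists of the rest.  By the
-- colouring principle A contains four edges such that no vertex of A is
-- adjacent to two of the eight ends, whence 8d ≤ 4|P| + |A|.  Counting the
-- edges that leave P gives 5d ≤ 5|I₂| + 3|A|.  Together |A| ≤ 20 f(n), and all
-- the bounds follow; v ∈ A is mapped to a subset of N(v) ∩ P.
module Submission where

open import Defs

-- Linear inequalities over the natural numbers, certified by multipliers.

module LinearArithmetic where

  open import Data.Bool using (Bool; true; T; _∧_)
  open import Data.Bool.Properties using (T-∧)
  open import Data.Fin using (Fin; zero; suc)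
  open import Data.List using (List; []; _∷_)
  open import Data.Nat using (ℕ; zero; suc; _+_; _*_; _≤_; _≤ᵇ_; z≤n)
  open import Data.Nat.Properties
  open import Data.Product using (_,_)
  open import Data.Vec using (Vec; []; _∷_; lookup; replicate; zipWith; map)
  open import Function using (Equivalence)
  open import Relation.Binary.PropositionalEquality hiding ([_])
  open import Algebra.Properties.CommutativeSemigroup +-commutativeSemigroup using (interchange)

  private variable k m : ℕ

  infixl 7 _⊕_
  infixl 8 _⊛_
  data Lin (k : ℕ) : Set where
    con : ℕ → Lin k
    var : Fin k → Lin k
    _⊕_ : Lin k → Lin k → Lin k
    _⊛_ : ℕ → Lin k → Lin k

  ⟦_⟧ : Lin k → Vec ℕ k → ℕ
  ⟦ con c ⟧ ρ = c
  ⟦ var i ⟧ ρ = lookup ρ i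
  ⟦ e ⊕ e′ ⟧ ρ = ⟦ e ⟧ ρ + ⟦ e′ ⟧ ρ
  ⟦ c ⊛ e ⟧ ρ = c * ⟦ e ⟧ ρ

  unit : Fin k → Vec ℕ k
  unit zero = 1 ∷ replicate _ 0
  unit (suc i) = 0 ∷ unit i

  -- The constant term comes first, to be paired with a leading 1 in the valuation.
  coeffs : Lin k → Vec ℕ (suc k)
  coeffs (con c) = c ∷ replicate _ 0
  coeffs (var i) = 0 ∷ unit i
  coeffs (e ⊕ e′) = zipWith _+_ (coeffs e) (coeffs e′)
  coeffs (c ⊛ e) = map (c *_) (coeffs e)

  dot : Vec ℕ m → Vec ℕ m → ℕ
  dot [] [] = 0
  dot (a ∷ as) (x ∷ xs) = a * x + dot as xs

  dot-zeros : (xs : Vec ℕ m) → dot (replicate m 0) xs ≡ 0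
  dot-zeros [] = refl
  dot-zeros (x ∷ xs) = dot-zeros xs

  dot-unit : (i : Fin m) (xs : Vec ℕ m) → dot (unit i) xs ≡ lookup xs i
  dot-unit zero (x ∷ xs) rewrite dot-zeros xs | +-identityʳ (x + 0) = +-identityʳ x
  dot-unit (suc i) (x ∷ xs) = dot-unit i xs

  dot-+ : (as bs xs : Vec ℕ m) → dot (zipWith _+_ as bs) xs ≡ dot as xs + dot bs xs
  dot-+ [] [] [] = refl
  dot-+ (a ∷ as) (b ∷ bs) (x ∷ xs) rewrite dot-+ as bs xs | *-distribʳ-+ x a b =
    interchange (a * x) (b * x) (dot as xs) (dot bs xs)

  dot-* : ∀ c (as xs : Vec ℕ m) → dot (map (c *_) as) xs ≡ c * dot as xs
  dot-* c [] [] = sym (*-zeroʳ c)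
  dot-* c (a ∷ as) (x ∷ xs) rewrite dot-* c as xs | *-assoc c a x =
    sym (*-distribˡ-+ c (a * x) (dot as xs))

  dot-coeffs : (e : Lin k) (ρ : Vec ℕ k) → dot (coeffs e) (1 ∷ ρ) ≡ ⟦ e ⟧ ρ
  dot-coeffs (con c) ρ rewrite dot-zeros ρ | *-identityʳ c = +-identityʳ c
  dot-coeffs (var i) ρ = dot-unit i ρ
  dot-coeffs (e ⊕ e′) ρ rewrite dot-+ (coeffs e) (coeffs e′) (1 ∷ ρ) =
    cong₂ _+_ (dot-coeffs e ρ) (dot-coeffs e′ ρ)
  dot-coeffs (c ⊛ e) ρ rewrite dot-* c (coeffs e) (1 ∷ ρ) = cong (c *_) (dot-coeffs e ρ)

  -- Boolean-valued: on closed coefficient vectors that compare correctly, `T (as ≤ᵛ bs)` evaluates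
  -- to the unit type, so the implicit argument of `linear` is filled in by evaluation.
  _≤ᵛ_ : Vec ℕ m → Vec ℕ m → Bool
  [] ≤ᵛ [] = true
  (a ∷ as) ≤ᵛ (b ∷ bs) = (a ≤ᵇ b) ∧ (as ≤ᵛ bs)

  dot-mono : (as bs xs : Vec ℕ m) → T (as ≤ᵛ bs) → dot as xs ≤ dot bs xs
  dot-mono [] [] [] _ = z≤n
  dot-mono (a ∷ as) (b ∷ bs) (x ∷ xs) a≤b =
    let a≤ᵇb , as≤bs = Equivalence.to T-∧ a≤b in
    +-mono-≤ (*-monoˡ-≤ x (≤ᵇ⇒≤ a b a≤ᵇb)) (dot-mono as bs xs as≤bs)

  infix 6 _·_≼_by_
  data Hyp (ρ : Vec ℕ k) : Set where
    _·_≼_by_ : ∀ (c : ℕ) (l r : Lin k) → ⟦ l ⟧ ρ ≤ ⟦ r ⟧ ρ → Hyp ρ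

  module _ {ρ : Vec ℕ k} where

    lhs rhs : List (Hyp ρ) → Lin k
    lhs [] = con 0
    lhs ((c · l ≼ r by _) ∷ hs) = c ⊛ l ⊕ lhs hs
    rhs [] = con 0
    rhs ((c · l ≼ r by _) ∷ hs) = c ⊛ r ⊕ rhs hs

    lhs≤rhs : (hs : List (Hyp ρ)) → ⟦ lhs hs ⟧ ρ ≤ ⟦ rhs hs ⟧ ρ
    lhs≤rhs [] = z≤n
    lhs≤rhs ((c · l ≼ r by l≤r) ∷ hs) = +-mono-≤ (*-monoʳ-≤ c l≤r) (lhs≤rhs hs)

  -- A Farkas certificate: suc c times the conclusion follows from the multiplied
  -- hypotheses by comparing coefficients, as the variables are nonnegative.
  linear : (ρ : Vec ℕ k) (hs : List (Hyp ρ)) (c : ℕ) (l r : Lin k) →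
           {_ : T (coeffs (suc c ⊛ l ⊕ rhs hs) ≤ᵛ coeffs (suc c ⊛ r ⊕ lhs hs))} →
           ⟦ l ⟧ ρ ≤ ⟦ r ⟧ ρ
  linear ρ hs c l r {ok} = *-cancelˡ-≤ (suc c) (+-cancelʳ-≤ (⟦ rhs hs ⟧ ρ) _ _ (begin
    suc c * ⟦ l ⟧ ρ + ⟦ rhs hs ⟧ ρ             ≡⟨ dot-coeffs (suc c ⊛ l ⊕ rhs hs) ρ ⟨
    dot (coeffs (suc c ⊛ l ⊕ rhs hs)) (1 ∷ ρ)  ≤⟨ dot-mono (coeffs (suc c ⊛ l ⊕ rhs hs)) (coeffs (suc c ⊛ r ⊕ lhs hs)) (1 ∷ ρ) ok ⟩
    dot (coeffs (suc c ⊛ r ⊕ lhs hs)) (1 ∷ ρ)  ≡⟨ dot-coeffs (suc c ⊛ r ⊕ lhs hs) ρ ⟩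
    suc c * ⟦ r ⟧ ρ + ⟦ lhs hs ⟧ ρ             ≤⟨ +-monoʳ-≤ _ (lhs≤rhs hs) ⟩
    suc c * ⟦ r ⟧ ρ + ⟦ rhs hs ⟧ ρ             ∎))
    where open ≤-Reasoning

-- Indicator sums, cardinalities and relabelling of subsets.

module Counting where

  open import Data.Bool using (true; false; if_then_else_)
  open import Data.Fin using (Fin; zero; suc)
  open import Data.Fin.Subset using (Subset; _∈_; _⊆_; Nonempty; ∣_∣; ⊥)
  open import Data.Fin.Subset.Properties using (_∈?_; nonempty?; Empty-unique; ∣⊥∣≡0; ⊥⊆; ∉⊥; s⊆s; drop-∷-⊆)
  open import Data.Nat using (ℕ; zero; suc; _+_; _*_; _≤_; z≤n; s≤s)
  open import Data.Nat.Properties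
  open import Data.Product using (_×_; _,_; ∃-syntax)
  open import Data.Sum using (_⊎_; inj₁; inj₂)
  open import Data.Vec using (Vec; []; _∷_; tabulate; here; there)
  open import Data.Vec.Properties using (lookup∘tabulate; lookup⇒[]=; []=⇒lookup)
  open import Function using (_∘_)
  open import Relation.Binary.PropositionalEquality hiding ([_])
  open import Relation.Nullary using (Dec; yes; no; does; ¬_; contradiction)
  open import Relation.Nullary.Decidable using (dec-true; _×-dec_)
  open import Algebra.Properties.Semiring.Sum +-*-semiring public

  private variable n : ℕ

  𝟙 : {P : Set} → Dec P → ℕ
  𝟙 p = if does p then 1 else 0

  sum-mono : {f g : Fin n → ℕ} → (∀ i → f i ≤ g i) → sum f ≤ sum g
  sum-mono {zero} f≤g = z≤n
  sum-mono {suc n} f≤g = +-mono-≤ (f≤g zero) (sum-mono (f≤g ∘ suc))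

  sum-const : ∀ n c → sum {n} (λ _ → c) ≡ n * c
  sum-const zero c = refl
  sum-const (suc n) c = cong (c +_) (sum-const n c)

  ind : Subset n → Fin n → ℕ
  ind S x = 𝟙 (x ∈? S)

  ∣∣≡sum : (S : Subset n) → ∣ S ∣ ≡ sum (ind S)
  ∣∣≡sum [] = refl
  ∣∣≡sum (true ∷ S) = cong suc (∣∣≡sum S)
  ∣∣≡sum (false ∷ S) = ∣∣≡sum S

  ⟪_⟫ : {P : Fin n → Set} → (∀ x → Dec (P x)) → Subset n
  ⟪ P? ⟫ = tabulate (does ∘ P?)

  ∈⟪⟫⁺ : {P : Fin n → Set} (P? : ∀ x → Dec (P x)) {x : Fin n} → P x → x ∈ ⟪ P? ⟫
  ∈⟪⟫⁺ P? {x} px = lookup⇒[]= x _ (trans (lookup∘tabulate (does ∘ P?) x) (dec-true (P? x) px))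

  ∈⟪⟫⁻ : {P : Fin n → Set} (P? : ∀ x → Dec (P x)) {x : Fin n} → x ∈ ⟪ P? ⟫ → P x
  ∈⟪⟫⁻ P? {x} x∈ with P? x | trans (sym (lookup∘tabulate (does ∘ P?) x)) ([]=⇒lookup x∈)
  ... | yes px | _ = px

  ∣⟪⟫∣≡sum : {P : Fin n → Set} (P? : ∀ x → Dec (P x)) → ∣ ⟪ P? ⟫ ∣ ≡ sum (𝟙 ∘ P?)
  ∣⟪⟫∣≡sum {zero} P? = refl
  ∣⟪⟫∣≡sum {suc n} P? with P? zero
  ... | yes _ = cong suc (∣⟪⟫∣≡sum (P? ∘ suc))
  ... | no _ = ∣⟪⟫∣≡sum (P? ∘ suc)

  subset-of-size : ∀ m (S : Subset n) → m ≤ ∣ S ∣ → ∃[ T ] (T ⊆ S × ∣ T ∣ ≡ m)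
  subset-of-size {n} zero S _ = ⊥ , ⊥⊆ , ∣⊥∣≡0 n
  subset-of-size (suc m) (true ∷ S) (s≤s m≤) =
    let T , T⊆S , ∣T∣≡m = subset-of-size m S m≤ in true ∷ T , s⊆s T⊆S , cong suc ∣T∣≡m
  subset-of-size (suc m) (false ∷ S) m≤ =
    let T , T⊆S , ∣T∣≡m = subset-of-size (suc m) S m≤ in false ∷ T , s⊆s T⊆S , ∣T∣≡m

  𝟙-01 : {P : Set} (p : Dec P) → 𝟙 p ≡ 0 ⊎ 𝟙 p ≡ 1
  𝟙-01 (yes _) = inj₂ refl
  𝟙-01 (no _) = inj₁ refl

  𝟙-⇔ : {P Q : Set} (p : Dec P) (q : Dec Q) → (P → Q) → (Q → P) → 𝟙 p ≡ 𝟙 q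
  𝟙-⇔ (yes _) (yes _) _ _ = refl
  𝟙-⇔ (yes p) (no ¬q) to _ = contradiction (to p) ¬q
  𝟙-⇔ (no ¬p) (yes q) _ from = contradiction (from q) ¬p
  𝟙-⇔ (no _) (no _) _ _ = refl

  exclusive-01 : {P Q : Set} (p : Dec P) (q : Dec Q) → ¬ (P × Q) → 𝟙 p + 𝟙 q ≡ 0 ⊎ 𝟙 p + 𝟙 q ≡ 1
  exclusive-01 (yes p) (yes q) pq = contradiction (p , q) pq
  exclusive-01 (yes p) (no _) _ = inj₂ refl
  exclusive-01 (no _) (yes q) _ = inj₂ refl
  exclusive-01 (no _) (no _) _ = inj₁ refl

  𝟙*≤ : {P : Set} (p : Dec P) (m : ℕ) → 𝟙 p * m ≤ m
  𝟙*≤ (yes _) m = ≤-reflexive (*-identityˡ m)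
  𝟙*≤ (no _) m = z≤n

  count-no : {P : Set} (p : Dec P) → ¬ P → 𝟙 p ≡ 0
  count-no (yes p) ¬p = contradiction p ¬p
  count-no (no _) _ = refl

  count-yes : {P : Set} (p : Dec P) → P → 𝟙 p ≡ 1
  count-yes (yes _) _ = refl
  count-yes (no ¬p) p = contradiction p ¬p

  count-both-no : {P Q : Set} (p : Dec P) (q : Dec Q) → ¬ (P × Q) → 𝟙 p * 𝟙 q ≡ 0
  count-both-no (yes p) (yes q) pq = contradiction (p , q) pq
  count-both-no (yes _) (no _) _ = refl
  count-both-no (no _) _ _ = refl

  count-exclusive₂ : {P Q : Set} (p : Dec P) (q : Dec Q) → ¬ (P × Q) → 𝟙 p + 𝟙 q ≤ 1
  count-exclusive₂ p q pq with exclusive-01 p q pq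
  ... | inj₁ eq = ≤-trans (≤-reflexive eq) z≤n
  ... | inj₂ eq = ≤-reflexive eq

  module _ {P Q R : Set} where
    -- Inclusion-exclusion: only `P` and `R` can hold together, and the product pays for that
    -- overlap.
    count-exclusive₃ : (p : Dec P) (q : Dec Q) (r : Dec R) → ¬ (P × Q) → ¬ (Q × R) →
                       𝟙 p + 𝟙 q + 𝟙 r ≤ 1 + 𝟙 p * 𝟙 r
    count-exclusive₃ (yes p) (yes q) r pq qr = contradiction (p , q) pq
    count-exclusive₃ p (yes q) (yes r) pq qr = contradiction (q , r) qr
    count-exclusive₃ (yes p) (no q) (yes r) pq qr = ≤-refl
    count-exclusive₃ (yes p) (no q) (no r) pq qr = ≤-refl
    count-exclusive₃ (no p) (yes q) (no r) pq qr = ≤-refl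
    count-exclusive₃ (no p) (no q) (yes r) pq qr = ≤-refl
    count-exclusive₃ (no p) (no q) (no r) pq qr = z≤n

    count-within₂ : (p : Dec P) (q : Dec Q) (r : Dec R) → ¬ (P × Q) → 𝟙 p * 𝟙 r + 𝟙 q * 𝟙 r ≤ 𝟙 r
    count-within₂ (yes p) (yes q) r pq = contradiction (p , q) pq
    count-within₂ (yes p) (no q) (yes r) pq = ≤-refl
    count-within₂ (no p) (yes q) (yes r) pq = ≤-refl
    count-within₂ (no p) (no q) (yes r) pq = z≤n
    count-within₂ (yes p) (no q) (no r) pq = ≤-refl
    count-within₂ (no p) (yes q) (no r) pq = ≤-refl
    count-within₂ (no p) (no q) (no r) pq = ≤-refl

  -- Inclusion-exclusion inside `R`: `W` excludes both `P` and `Q`, so only the overlap of these two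
  -- is counted twice.
  count-within₃ : {P Q W R : Set} (p : Dec P) (q : Dec Q) (w : Dec W) (r : Dec R) → ¬ (P × W) → ¬ (Q × W) →
                  𝟙 p * 𝟙 r + 𝟙 q * 𝟙 r + 𝟙 w * 𝟙 r ≤ 𝟙 r + 𝟙 p * 𝟙 q * 𝟙 r
  count-within₃ (yes p) q (yes w) r pw qw = contradiction (p , w) pw
  count-within₃ p (yes q) (yes w) r pw qw = contradiction (q , w) qw
  count-within₃ (yes _) (yes _) (no _) (yes _) _ _ = ≤-refl
  count-within₃ (yes _) (no _) (no _) (yes _) _ _ = ≤-refl
  count-within₃ (no _) (yes _) (no _) (yes _) _ _ = ≤-refl
  count-within₃ (no _) (no _) (yes _) (yes _) _ _ = ≤-refl
  count-within₃ (no _) (no _) (no _) (yes _) _ _ = z≤n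
  count-within₃ (yes _) (yes _) (no _) (no _) _ _ = ≤-refl
  count-within₃ (yes _) (no _) (no _) (no _) _ _ = ≤-refl
  count-within₃ (no _) (yes _) (no _) (no _) _ _ = ≤-refl
  count-within₃ (no _) (no _) (yes _) (no _) _ _ = ≤-refl
  count-within₃ (no _) (no _) (no _) (no _) _ _ = ≤-refl

  sum₃ : ∀ {n} (f g h : Fin n → ℕ) → sum (λ x → f x + g x + h x) ≡ sum f + sum g + sum h
  sum₃ f g h = trans (∑-distrib-+ (λ x → f x + g x) h) (cong (_+ sum h) (∑-distrib-+ f g))

  sum-1 : ∀ n → sum {n} (λ _ → 1) ≡ n
  sum-1 n = trans (sum-const n 1) (*-identityʳ n)

  Fin⇒1≤ : ∀ {n} → Fin n → 1 ≤ n
  Fin⇒1≤ {suc n} _ = s≤s z≤n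

  𝟙-× : {P Q : Set} (p : Dec P) (q : Dec Q) → 𝟙 (p ×-dec q) ≡ 𝟙 p * 𝟙 q
  𝟙-× (yes _) (yes _) = refl
  𝟙-× (yes _) (no _) = refl
  𝟙-× (no _) _ = refl

  1≤∣∣⇒Nonempty : ∀ {n} (S : Subset n) → 1 ≤ ∣ S ∣ → Nonempty S
  1≤∣∣⇒Nonempty {n} S 1≤ with nonempty? S
  ... | yes ne = ne
  ... | no empty = contradiction (subst (1 ≤_) (trans (cong ∣_∣ (Empty-unique empty)) (∣⊥∣≡0 n)) 1≤) λ ()

  -- Relabels the elements of `P` in increasing order by the first points of `Fin N` and transports
  -- `T ∩ P` along; surplus points lie in no image. This carries subsets of `P` to the ground set of
  -- a Kneser graph.
  compress : (P : Subset n) (N : ℕ) → ∣ P ∣ ≤ N → Subset n → Subset N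
  compress [] N _ [] = ⊥
  compress (true ∷ P) (suc N) (s≤s P≤N) (t ∷ T) = t ∷ compress P N P≤N T
  compress (false ∷ P) N P≤N (t ∷ T) = compress P N P≤N T

  ∣compress∣ : (P : Subset n) (N : ℕ) (P≤N : ∣ P ∣ ≤ N) (T : Subset n) →
               T ⊆ P → ∣ compress P N P≤N T ∣ ≡ ∣ T ∣
  ∣compress∣ [] N _ [] _ = ∣⊥∣≡0 N
  ∣compress∣ (true ∷ P) (suc N) (s≤s P≤N) (true ∷ T) T⊆P = cong suc (∣compress∣ P N P≤N T (drop-∷-⊆ T⊆P))
  ∣compress∣ (true ∷ P) (suc N) (s≤s P≤N) (false ∷ T) T⊆P = ∣compress∣ P N P≤N T (drop-∷-⊆ T⊆P)
  ∣compress∣ (false ∷ P) N P≤N (true ∷ T) T⊆P = contradiction (T⊆P here) λ ()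
  ∣compress∣ (false ∷ P) N P≤N (false ∷ T) T⊆P = ∣compress∣ P N P≤N T (drop-∷-⊆ T⊆P)

  -- The relabelling is injective on `P`, so disjoint sets keep disjoint images.
  ∈compress∩ : (P : Subset n) (N : ℕ) (P≤N : ∣ P ∣ ≤ N) (S T : Subset n) → ∀ {i} →
               i ∈ compress P N P≤N S → i ∈ compress P N P≤N T → ∃[ x ] (x ∈ S × x ∈ T)
  ∈compress∩ [] N _ [] [] i∈ _ = contradiction i∈ ∉⊥
  ∈compress∩ (true ∷ P) (suc N) (s≤s P≤N) (s ∷ S) (t ∷ T) here here = zero , here , here
  ∈compress∩ (true ∷ P) (suc N) (s≤s P≤N) (s ∷ S) (t ∷ T) (there i∈S) (there i∈T) =
    let x , x∈S , x∈T = ∈compress∩ P N P≤N S T i∈S i∈T in suc x , there x∈S , there x∈T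
  ∈compress∩ (false ∷ P) N P≤N (s ∷ S) (t ∷ T) i∈S i∈T =
    let x , x∈S , x∈T = ∈compress∩ P N P≤N S T i∈S i∈T in suc x , there x∈S , there x∈T

-- Quadratic forms and the energy of a kernel.

module QuadraticForms where

  open import Data.Fin using (Fin; zero; suc)
  open import Data.Integer using (ℤ; +_; -[1+_]; ∣_∣; 0ℤ; _+_; _*_; -_)
  open import Data.Integer.Properties as ℤₚ using (+-*-semiring)
  open import Data.Integer.Tactic.RingSolver using (solve-∀)
  open import Data.Nat as ℕ using (ℕ; zero; suc)
  open import Data.Sum using (_⊎_; inj₁; inj₂)
  open import Data.Vec using (Vec; []; _∷_)
  open import Function using (_∘_)
  open import Relation.Binary.PropositionalEquality hiding ([_])
  open import Algebra.Properties.Semiring.Sum +-*-semiring as ℤΣ using () renaming (sum to sumℤ)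
  open Counting using (sum; sum-const; sum-cong-≗)
  open ≡-Reasoning

  private variable n : ℕ

  pos-sum : (f : Fin n → ℕ) → + sum f ≡ sumℤ (λ x → + f x)
  pos-sum {zero} f = refl
  pos-sum {suc n} f = trans (ℤₚ.pos-+ (f zero) (sum (f ∘ suc))) (cong (λ s → + f zero + s) (pos-sum (f ∘ suc)))

  pos-∣∣² : ∀ i → + (∣ i ∣ ℕ.* ∣ i ∣) ≡ i * i
  pos-∣∣² (+ m) = ℤₚ.pos-* m m
  pos-∣∣² -[1+ m ] = refl

  Kernel : ℕ → Set
  Kernel n = Fin n → Fin n → ℤ

  ∬ : Kernel n → ℤ
  ∬ F = sumℤ λ x → sumℤ λ w → F x w

  ∬-cong : {F F′ : Kernel n} → (∀ x w → F x w ≡ F′ x w) → ∬ F ≡ ∬ F′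
  ∬-cong eq = ℤΣ.sum-cong-≗ λ x → ℤΣ.sum-cong-≗ (eq x)

  ∬-+ : (F F′ : Kernel n) → ∬ (λ x w → F x w + F′ x w) ≡ ∬ F + ∬ F′
  ∬-+ F F′ = trans (ℤΣ.sum-cong-≗ λ x → ℤΣ.∑-distrib-+ (F x) (F′ x)) (ℤΣ.∑-distrib-+ (λ x → sumℤ (F x)) _)

  ∬-* : ∀ c (F : Kernel n) → ∬ (λ x w → c * F x w) ≡ c * ∬ F
  ∬-* c F = trans (ℤΣ.sum-cong-≗ λ x → sym (ℤΣ.*-distribˡ-sum c (F x))) (sym (ℤΣ.*-distribˡ-sum c (λ x → sumℤ (F x))))

  ∬-⊗ : (f g : Fin n → ℤ) → ∬ (λ x w → f x * g w) ≡ sumℤ f * sumℤ g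
  ∬-⊗ f g = trans (ℤΣ.sum-cong-≗ λ x → sym (ℤΣ.*-distribˡ-sum (f x) g)) (sym (ℤΣ.*-distribʳ-sum (sumℤ g) f))

  infix 8 _∙_
  _∙_ : (f g : Fin n → ℤ) → ℤ
  f ∙ g = sumℤ λ x → f x * g x

  form : Kernel n → (Fin n → ℤ) → ℤ
  form F u = ∬ λ x w → F x w * (u x * u w)

  form-⊗ : (v u : Fin n → ℤ) → form (λ x w → v x * v w) u ≡ (v ∙ u) * (v ∙ u)
  form-⊗ v u = trans (∬-cong λ x w → shuffle (v x) (v w) (u x) (u w)) (∬-⊗ (λ x → v x * u x) (λ x → v x * u x))
    where
    shuffle : ∀ a b c d → a * b * (c * d) ≡ a * c * (b * d)
    shuffle = solve-∀

  form-+ : (F F′ : Kernel n) (u : Fin n → ℤ) → form (λ x w → F x w + F′ x w) u ≡ form F u + form F′ u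
  form-+ F F′ u = trans (∬-cong λ x w → ℤₚ.*-distribʳ-+ (u x * u w) (F x w) (F′ x w))
                        (∬-+ (λ x w → F x w * (u x * u w)) (λ x w → F′ x w * (u x * u w)))

  form-* : ∀ c (F : Kernel n) (u : Fin n → ℤ) → form (λ x w → c * F x w) u ≡ c * form F u
  form-* c F u = trans (∬-cong λ x w → ℤₚ.*-assoc c (F x w) (u x * u w)) (∬-* c (λ x w → F x w * (u x * u w)))

  -- The squared Frobenius norm after a rank-one update: the cross term is a quadratic form, and
  -- `u ⊗ u` has squared norm `(u ∙ u)²`.
  ∬-square-⊗ : (F : Kernel n) (u : Fin n → ℤ) →
               ∬ (λ x w → (F x w + u x * u w) * (F x w + u x * u w)) ≡
               ∬ (λ x w → F x w * F x w) + + 2 * form F u + (u ∙ u) * (u ∙ u)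
  ∬-square-⊗ F u = begin
    ∬ (λ x w → (F x w + u x * u w) * (F x w + u x * u w))
      ≡⟨ (∬-cong λ x w → expand (F x w) (u x) (u w)) ⟩
    ∬ (λ x w → F² x w + + 2 * Fu² x w + u² x * u² w)
      ≡⟨ ∬-+ (λ x w → F² x w + + 2 * Fu² x w) (λ x w → u² x * u² w) ⟩
    ∬ (λ x w → F² x w + + 2 * Fu² x w) + ∬ (λ x w → u² x * u² w)
      ≡⟨ cong₂ _+_ (∬-+ F² (λ x w → + 2 * Fu² x w)) (∬-⊗ u² u²) ⟩
    ∬ F² + ∬ (λ x w → + 2 * Fu² x w) + (u ∙ u) * (u ∙ u)
      ≡⟨ cong (λ t → ∬ F² + t + (u ∙ u) * (u ∙ u)) (∬-* (+ 2) Fu²) ⟩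
    ∬ F² + + 2 * form F u + (u ∙ u) * (u ∙ u) ∎
    where
    F² Fu² : Kernel _
    F² x w = F x w * F x w
    Fu² x w = F x w * (u x * u w)
    u² : Fin _ → ℤ
    u² x = u x * u x
    expand : ∀ f a b → (f + a * b) * (f + a * b) ≡ f * f + + 2 * (f * (a * b)) + a * a * (b * b)
    expand = solve-∀

  module Energy {n : ℕ} (a : Fin n → Fin n → ℕ) (a-01 : ∀ x w → a x w ≡ 0 ⊎ a x w ≡ 1) where

    A : Kernel n
    A x w = + a x w

    -- 10 (2 A − 1) + Σ u ⊗ u
    kernel : ∀ {j} → Vec (Fin n → ℤ) j → Kernel n
    kernel [] x w = + 20 * A x w + - + 10 * + 1
    kernel (u ∷ us) x w = kernel us x w + u x * u w

    opaque
      -- The squared Frobenius norm of the kernel, taken with absolute values so that its type makes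
      -- it nonnegative.
      energy : ∀ {j} → Vec (Fin n → ℤ) j → ℕ
      energy us = sum λ x → sum λ w → ∣ kernel us x w ∣ ℕ.* ∣ kernel us x w ∣

      -- The value at `u` of the quadratic form `Σ v ⊗ v`: it measures how far `u` is from being
      -- orthogonal to the earlier vectors.
      gram : ∀ {j} → Vec (Fin n → ℤ) j → (Fin n → ℤ) → ℕ
      gram [] u = 0
      gram (v ∷ us) u = gram us u ℕ.+ ∣ v ∙ u ∣ ℕ.* ∣ v ∙ u ∣

      gram-[] : ∀ u → gram [] u ≡ 0
      gram-[] u = refl

      gram-∷ : ∀ v {j} (us : Vec (Fin n → ℤ) j) u → gram (v ∷ us) u ≡ gram us u ℕ.+ ∣ v ∙ u ∣ ℕ.* ∣ v ∙ u ∣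
      gram-∷ v us u = refl

      pos-energy : ∀ {j} (us : Vec (Fin n → ℤ) j) → + energy us ≡ ∬ (λ x w → kernel us x w * kernel us x w)
      pos-energy us = trans (pos-sum (λ x → sum λ w → k² x w))
        (ℤΣ.sum-cong-≗ λ x → trans (pos-sum (k² x)) (ℤΣ.sum-cong-≗ λ w → pos-∣∣² (kernel us x w)))
        where
        k² : Fin n → Fin n → ℕ
        k² x w = ∣ kernel us x w ∣ ℕ.* ∣ kernel us x w ∣

      -- Every entry of the initial kernel is 10 or -10.
      energy-[] : energy [] ≡ n ℕ.* (n ℕ.* 100)
      energy-[] = trans (sum-cong-≗ λ x → trans (sum-cong-≗ λ w → k²≡100 (a x w) (a-01 x w)) (sum-const n 100)) (sum-const n _)
        where
        k²≡100 : ∀ t → t ≡ 0 ⊎ t ≡ 1 → let k = + 20 * + t + - + 10 * + 1 in ∣ k ∣ ℕ.* ∣ k ∣ ≡ 100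
        k²≡100 _ (inj₁ refl) = refl
        k²≡100 _ (inj₂ refl) = refl

    opaque
      unfolding gram

      -- As `u` sums to zero, the all-ones part of the kernel vanishes on it.
      form-kernel : ∀ {j} (us : Vec (Fin n → ℤ) j) (u : Fin n → ℤ) → sumℤ u ≡ 0ℤ →
                    form (kernel us) u ≡ + 20 * form A u + + gram us u
      form-kernel [] u Σu≡0 = begin
        form (λ x w → + 20 * A x w + - + 10 * + 1) u
          ≡⟨ form-+ (λ x w → + 20 * A x w) (λ _ _ → - + 10 * + 1) u ⟩
        form (λ x w → + 20 * A x w) u + form (λ _ _ → - + 10 * + 1) u
          ≡⟨ cong₂ _+_ (form-* (+ 20) A u) (form-* (- + 10) (λ _ _ → + 1) u) ⟩
        + 20 * form A u + - + 10 * form (λ _ _ → + 1) u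
          ≡⟨ cong (λ t → + 20 * form A u + - + 10 * t) form-1 ⟩
        + 20 * form A u + + 0  ∎
        where
        form-1 : form (λ _ _ → + 1) u ≡ 0ℤ
        form-1 = trans (∬-cong λ x w → ℤₚ.*-identityˡ (u x * u w)) (trans (∬-⊗ u u) (cong (_* sumℤ u) Σu≡0))
      form-kernel (v ∷ us) u Σu≡0 = begin
        form (kernel (v ∷ us)) u
          ≡⟨ form-+ (kernel us) (λ x w → v x * v w) u ⟩
        form (kernel us) u + form (λ x w → v x * v w) u
          ≡⟨ cong₂ _+_ (form-kernel us u Σu≡0) (form-⊗ v u) ⟩
        + 20 * form A u + + gram us u + (v ∙ u) * (v ∙ u)
          ≡⟨ cong (λ t → + 20 * form A u + + gram us u + t) (sym (pos-∣∣² (v ∙ u))) ⟩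
        + 20 * form A u + + gram us u + + (∣ v ∙ u ∣ ℕ.* ∣ v ∙ u ∣)
          ≡⟨ ℤₚ.+-assoc (+ 20 * form A u) (+ gram us u) _ ⟩
        + 20 * form A u + + gram (v ∷ us) u ∎

    -- The contribution `2 · 20 · form A u = −40 g` of the cross term is moved to the left, so that
    -- the identity holds in ℕ.
    energy-∷ : ∀ {j} (us : Vec (Fin n → ℤ) j) (u : Fin n → ℤ) {g m : ℕ} →
               sumℤ u ≡ 0ℤ → form A u ≡ - + g → u ∙ u ≡ + m →
               energy (u ∷ us) ℕ.+ 40 ℕ.* g ≡ energy us ℕ.+ 2 ℕ.* gram us u ℕ.+ m ℕ.* m
    energy-∷ us u {g} {m} Σu≡0 uAu≡-g u∙u≡m = ℤₚ.+-injective (begin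
      + (energy (u ∷ us) ℕ.+ 40 ℕ.* g)
        ≡⟨ cong (λ t → + energy (u ∷ us) + t) (ℤₚ.pos-* 40 g) ⟩
      + energy (u ∷ us) + + 40 * + g
        ≡⟨ cong (λ t → t + + 40 * + g) (trans (pos-energy (u ∷ us)) (∬-square-⊗ (kernel us) u)) ⟩
      ∬ (λ x w → kernel us x w * kernel us x w) + + 2 * form (kernel us) u + (u ∙ u) * (u ∙ u) + + 40 * + g
        ≡⟨ cong₂ (λ s t → s + t + (u ∙ u) * (u ∙ u) + + 40 * + g) (sym (pos-energy us))
             (cong (λ t → + 2 * t) (trans (form-kernel us u Σu≡0) (cong (λ t → + 20 * t + + gram us u) uAu≡-g))) ⟩
      + energy us + + 2 * (+ 20 * - + g + + gram us u) + (u ∙ u) * (u ∙ u) + + 40 * + g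
        ≡⟨ cong (λ t → + energy us + + 2 * (+ 20 * - + g + + gram us u) + t * t + + 40 * + g) u∙u≡m ⟩
      + energy us + + 2 * (+ 20 * - + g + + gram us u) + + m * + m + + 40 * + g
        ≡⟨ cancel (+ energy us) (+ gram us u) (+ m * + m) (+ g) ⟩
      + energy us + + 2 * + gram us u + + m * + m
        ≡⟨ cong₂ (λ s t → + energy us + s + t) (sym (ℤₚ.pos-* 2 (gram us u))) (sym (ℤₚ.pos-* m m)) ⟩
      + (energy us ℕ.+ 2 ℕ.* gram us u ℕ.+ m ℕ.* m) ∎)
      where
      cancel : ∀ e r q g → e + + 2 * (+ 20 * - g + r) + q + + 40 * g ≡ e + + 2 * r + q
      cancel = solve-∀

-- Existence of a vertex of degree at least 0.56 n.

module HighDegreeVertex where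

  open import Data.Empty using (⊥)
  open import Data.Fin as Fin using (Fin; zero; suc; #_; combine; fromℕ<)
  open import Data.Fin.Properties using (any?; fromℕ<-injective; combine-injective)
  open import Data.Fin.Subset using (Subset; _∈_)
  open import Data.Fin.Subset.Properties using (_∈?_)
  import Data.Integer as ℤ
  open ℤ using (ℤ; +_; ∣_∣; 0ℤ; -1ℤ)
  import Data.Integer.Properties as ℤₚ
  open import Data.Integer.Tactic.RingSolver using (solve-∀)
  open import Data.List using ([]; _∷_)
  open import Data.Nat as ℕ using (ℕ; zero; suc; _+_; _*_; _≤_; _<_; _∸_; z≤n; NonZero; _^_)
  open import Data.Nat.Properties
  open import Data.Nat.DivMod using (_/_; _%_; m≡m%n+[m/n]*n; m%n<n; m<n*o⇒m/o<n)
  open import Data.Product using (_×_; _,_; proj₁; proj₂; ∃-syntax; Σ-syntax)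
  open import Data.Sum using (_⊎_; inj₁; inj₂)
  open import Data.Vec using (Vec; []; _∷_; map)
  open import Relation.Binary.PropositionalEquality hiding ([_])
  open import Relation.Nullary using (Dec; yes; no; ¬_; contradiction)
  open import Relation.Nullary.Decidable using (_×-dec_)
  open import Algebra.Properties.CommutativeSemigroup *-commutativeSemigroup using (x∙yz≈y∙xz)
  open import Algebra.Properties.Semiring.Sum ℤₚ.+-*-semiring as ℤΣ using () renaming (sum to sumℤ)
  open LinearArithmetic
  open Counting
  open QuadraticForms

  signed-square : {P Q : Set} (p : Dec P) (q : Dec Q) → ¬ (P × Q) →
                  (+ 𝟙 p ℤ.+ -1ℤ ℤ.* + 𝟙 q) ℤ.* (+ 𝟙 p ℤ.+ -1ℤ ℤ.* + 𝟙 q) ≡ + (𝟙 p + 𝟙 q)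
  signed-square (yes p) (yes q) pq = contradiction (p , q) pq
  signed-square (yes p) (no _) _ = refl
  signed-square (no _) (yes q) _ = refl
  signed-square (no _) (no _) _ = refl

  -- An edge cannot have both ends in the same one of the two sets, so wherever the product is
  -- nonzero the signs are opposite.
  signed-product : {E P Q P′ Q′ : Set} (e : Dec E) (p : Dec P) (q : Dec Q) (p′ : Dec P′) (q′ : Dec Q′) →
    ¬ (P × Q) → ¬ (P′ × Q′) → ¬ (E × P × P′) → ¬ (E × Q × Q′) →
    + 𝟙 e ℤ.* ((+ 𝟙 p ℤ.+ -1ℤ ℤ.* + 𝟙 q) ℤ.* (+ 𝟙 p′ ℤ.+ -1ℤ ℤ.* + 𝟙 q′)) ≡
    -1ℤ ℤ.* + (𝟙 e * ((𝟙 p + 𝟙 q) * (𝟙 p′ + 𝟙 q′)))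
  signed-product (no _) p q p′ q′ _ _ _ _ = refl
  signed-product (yes e) (yes p) (yes q) p′ q′ pq _ _ _ = contradiction (p , q) pq
  signed-product (yes e) p q (yes p′) (yes q′) _ pq′ _ _ = contradiction (p′ , q′) pq′
  signed-product (yes e) (yes p) q (yes p′) q′ _ _ pp′ _ = contradiction (e , p , p′) pp′
  signed-product (yes e) p (yes q) p′ (yes q′) _ _ _ qq′ = contradiction (e , q , q′) qq′
  signed-product (yes e) (yes p) (no _) (no _) (yes _) _ _ _ _ = refl
  signed-product (yes e) (yes p) (no _) (no _) (no _) _ _ _ _ = refl
  signed-product (yes e) (no _) (yes _) (yes _) (no _) _ _ _ _ = refl
  signed-product (yes e) (no _) (yes _) (no _) (no _) _ _ _ _ = refl
  signed-product (yes e) (no _) (no _) (yes _) (no _) _ _ _ _ = refl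
  signed-product (yes e) (no _) (no _) (no _) (yes _) _ _ _ _ = refl
  signed-product (yes e) (no _) (no _) (no _) (no _) _ _ _ _ = refl

  scaled-∣-∣ : ∀ c k s t → c * s ≤ c * t + k → c * t ≤ c * s + k →
               c * ∣ + s ℤ.+ -1ℤ ℤ.* + t ∣ ≤ k
  scaled-∣-∣ c k s t s≤t t≤s with ≤-total s t
  ... | inj₁ s≤ with r , refl ← m≤n⇒∃[o]m+o≡n s≤ = +-cancelˡ-≤ (c * s) _ _ (begin
    c * s + c * ∣ + s ℤ.+ -1ℤ ℤ.* + (s + r) ∣  ≡⟨ cong (λ i → c * s + c * ∣ i ∣) (eq (+ s) (+ r)) ⟩
    c * s + c * ∣ ℤ.- + r ∣                    ≡⟨ cong (λ i → c * s + c * i) (ℤₚ.∣-i∣≡∣i∣ (+ r)) ⟩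
    c * s + c * r                              ≡⟨ *-distribˡ-+ c s r ⟨
    c * (s + r)                                ≤⟨ t≤s ⟩
    c * s + k                                  ∎)
    where
    open ≤-Reasoning
    eq : ∀ s r → s ℤ.+ -1ℤ ℤ.* (s ℤ.+ r) ≡ ℤ.- r
    eq = solve-∀
  ... | inj₂ t≤ with r , refl ← m≤n⇒∃[o]m+o≡n t≤ = +-cancelˡ-≤ (c * t) _ _ (begin
    c * t + c * ∣ + (t + r) ℤ.+ -1ℤ ℤ.* + t ∣  ≡⟨ cong (λ i → c * t + c * ∣ i ∣) (eq (+ t) (+ r)) ⟩
    c * t + c * r                              ≡⟨ *-distribˡ-+ c t r ⟨
    c * (t + r)                                ≤⟨ s≤t ⟩
    c * t + k                                  ∎)
    where
    open ≤-Reasoning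
    eq : ∀ t r → t ℤ.+ r ℤ.+ -1ℤ ℤ.* t ≡ r
    eq = solve-∀

  same-quotient : ∀ s t n .{{_ : NonZero n}} → s / n ≡ t / n → s ≤ t + n
  same-quotient s t n s/n≡t/n = begin
    s                        ≡⟨ m≡m%n+[m/n]*n s n ⟩
    s % n + s / n * n        ≡⟨ cong (λ q → s % n + q * n) s/n≡t/n ⟩
    s % n + t / n * n        ≤⟨ +-mono-≤ (<⇒≤ (m%n<n s n)) (m≤n+m _ (t % n)) ⟩
    n + (t % n + t / n * n)  ≡⟨ cong (λ t → n + t) (m≡m%n+[m/n]*n t n) ⟨
    n + t                    ≡⟨ +-comm n t ⟩
    t + n                    ∎
    where open ≤-Reasoning

  -- The colouring principle: with fewer than `l` colours the colouring is not proper, and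
  -- decidability yields an actual edge.
  monochromatic-edge : ∀ {n k l} (G : SimpleGraph (Fin n)) → (∀ k → Colorable G k → l ≤ k) →
                       k < l → (c : Fin n → Fin k) → ∃[ u ] ∃[ v ] (Adj G u v × c u ≡ c v)
  monochromatic-edge {k = k} G l≤χ k<l c with any? (λ u → any? (λ v → adj? G u v ×-dec c u Fin.≟ c v))
  ... | yes e = e
  ... | no ∄e = contradiction (l≤χ k (c , λ u v u~v cu≡cv → ∄e (u , v , u~v , cu≡cv))) (<⇒≱ k<l)

  square-≤ : ∀ c k i → c * i ≤ k → c * c * (i * i) ≤ k * k
  square-≤ c k i ci≤k = ≤-trans (≤-reflexive ([m*n]*[o*p]≡[m*o]*[n*p] c c i i)) (*-mono-≤ ci≤k ci≤k)

  -- γ ≥ 2 dd + 1.12 nd − 0.56 nn; the multipliers come from 152 dd + 89.6 nd ≥ 45.8 nn + 4 Γ.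
  drop-arithmetic : ∀ (E′ E Γ γ dd nd nn : ℕ) →
    E′ + 40 * γ ≤ E + 2 * Γ + 4 * dd → 2000 * dd + 1120 * nd ≤ 1000 * γ + 560 * nn →
    60 * 60 * Γ ≤ 201 * nn → 333 * nd ≤ 1000 * dd → 333 * nn ≤ 1000 * nd → 2 * E′ + nn ≤ 2 * E
  drop-arithmetic E′ E Γ γ dd nd nn h₁ h₂ h₃ h₄ h₅ = linear (E′ ∷ E ∷ Γ ∷ γ ∷ dd ∷ nd ∷ nn ∷ [])
    ( 18000 · ⟨E′⟩ ⊕ 40 ⊛ ⟨γ⟩ ≼ ⟨E⟩ ⊕ 2 ⊛ ⟨Γ⟩ ⊕ 4 ⊛ ⟨dd⟩ by h₁
    ∷ 720 · 2000 ⊛ ⟨dd⟩ ⊕ 1120 ⊛ ⟨nd⟩ ≼ 1000 ⊛ ⟨γ⟩ ⊕ 560 ⊛ ⟨nn⟩ by h₂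
    ∷ 10 · (60 * 60) ⊛ ⟨Γ⟩ ≼ 201 ⊛ ⟨nn⟩ by h₃
    ∷ 1368 · 333 ⊛ ⟨nd⟩ ≼ 1000 ⊛ ⟨dd⟩ by h₄
    ∷ 1261 · 333 ⊛ ⟨nn⟩ ≼ 1000 ⊛ ⟨nd⟩ by h₅
    ∷ []) 8999 (2 ⊛ ⟨E′⟩ ⊕ ⟨nn⟩) (2 ⊛ ⟨E⟩)
    where
    ⟨E′⟩ ⟨E⟩ ⟨Γ⟩ ⟨γ⟩ ⟨dd⟩ ⟨nd⟩ ⟨nn⟩ : Lin 7
    ⟨E′⟩ = var (# 0)
    ⟨E⟩ = var (# 1)
    ⟨Γ⟩ = var (# 2)
    ⟨γ⟩ = var (# 3)
    ⟨dd⟩ = var (# 4)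
    ⟨nd⟩ = var (# 5)
    ⟨nn⟩ = var (# 6)

  -- The signed vector of an edge.

  module HighDegree {n : ℕ} (G : SimpleGraph (Fin n)) (triangle-free : TriangleFree G)
                    (d : ℕ) (d≤deg : ∀ v → d ≤ degree G v) where

    a : Fin n → Fin n → ℕ
    a x w = 𝟙 (adj? G x w)

    open Energy a (λ x w → 𝟙-01 (adj? G x w))

    deg≡sum : ∀ v → degree G v ≡ sum (a v)
    deg≡sum v = ∣⟪⟫∣≡sum (adj? G v)

    a-sym : ∀ x w → a x w ≡ a w x
    a-sym x w = 𝟙-⇔ (adj? G x w) (adj? G w x) (symm G) (symm G)

    -- Having exactly `d` elements in each set makes `u e` sum to zero.
    nb : Fin n → Subset n
    nb v = proj₁ (subset-of-size d (neighbours G v) (d≤deg v))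

    nb-adj : ∀ {v x} → x ∈ nb v → Adj G v x
    nb-adj {v} x∈nb = ∈⟪⟫⁻ (adj? G v) (proj₁ (proj₂ (subset-of-size d (neighbours G v) (d≤deg v))) x∈nb)

    p : Fin n → Fin n → ℕ
    p v = ind (nb v)

    sum-p : ∀ v → sum (p v) ≡ d
    sum-p v = trans (sym (∣∣≡sum (nb v))) (proj₂ (proj₂ (subset-of-size d (neighbours G v) (d≤deg v))))

    Edge : Set
    Edge = Σ[ y ∈ Fin n ] Σ[ z ∈ Fin n ] Adj G y z

    u : Edge → Fin n → ℤ
    u (y , z , _) x = + p y x ℤ.+ -1ℤ ℤ.* + p z x

    s : Edge → Fin n → ℕ
    s (y , z , _) x = p y x + p z x

    nb-disjoint : ∀ {y z} → Adj G y z → ∀ x → ¬ (x ∈ nb y × x ∈ nb z)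
    nb-disjoint y~z x (x∈y , x∈z) = triangle-free _ _ _ (y~z , nb-adj x∈z , nb-adj x∈y)

    s-01 : ∀ e x → s e x ≡ 0 ⊎ s e x ≡ 1
    s-01 (y , z , y~z) x = exclusive-01 (x ∈? nb y) (x ∈? nb z) (nb-disjoint y~z x)

    sum-s : ∀ e → sum (s e) ≡ d + d
    sum-s (y , z , _) = trans (∑-distrib-+ (p y) (p z)) (cong₂ _+_ (sum-p y) (sum-p z))

    sumℤ-u : ∀ e (f : Fin n → ℤ) → sumℤ (λ x → u e x ℤ.* f x) ≡
             sumℤ (λ x → + p (proj₁ e) x ℤ.* f x) ℤ.+ -1ℤ ℤ.* sumℤ (λ x → + p (proj₁ (proj₂ e)) x ℤ.* f x)
    sumℤ-u (y , z , _) f = begin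
      sumℤ (λ x → (+ p y x ℤ.+ -1ℤ ℤ.* + p z x) ℤ.* f x)
        ≡⟨ (ℤΣ.sum-cong-≗ λ x → expand (+ p y x) (+ p z x) (f x)) ⟩
      sumℤ (λ x → + p y x ℤ.* f x ℤ.+ -1ℤ ℤ.* (+ p z x ℤ.* f x))
        ≡⟨ ℤΣ.∑-distrib-+ (λ x → + p y x ℤ.* f x) (λ x → -1ℤ ℤ.* (+ p z x ℤ.* f x)) ⟩
      sumℤ (λ x → + p y x ℤ.* f x) ℤ.+ sumℤ (λ x → -1ℤ ℤ.* (+ p z x ℤ.* f x))
        ≡⟨ cong (λ t → sumℤ (λ x → + p y x ℤ.* f x) ℤ.+ t) (ℤΣ.*-distribˡ-sum -1ℤ (λ x → + p z x ℤ.* f x)) ⟨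
      sumℤ (λ x → + p y x ℤ.* f x) ℤ.+ -1ℤ ℤ.* sumℤ (λ x → + p z x ℤ.* f x) ∎
      where
      open ≡-Reasoning
      expand : ∀ b c f → (b ℤ.+ -1ℤ ℤ.* c) ℤ.* f ≡ b ℤ.* f ℤ.+ -1ℤ ℤ.* (c ℤ.* f)
      expand = solve-∀

    sum-u : ∀ e → sumℤ (u e) ≡ 0ℤ
    sum-u e@(y , z , _) = begin
      sumℤ (u e)                      ≡⟨ (ℤΣ.sum-cong-≗ λ x → sym (ℤₚ.*-identityʳ (u e x))) ⟩
      sumℤ (λ x → u e x ℤ.* + 1)      ≡⟨ sumℤ-u e (λ _ → + 1) ⟩
      sumℤ (λ x → + p y x ℤ.* + 1) ℤ.+ -1ℤ ℤ.* sumℤ (λ x → + p z x ℤ.* + 1)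
        ≡⟨ cong₂ (λ b c → b ℤ.+ -1ℤ ℤ.* c) (Σp y) (Σp z) ⟩
      + d ℤ.+ -1ℤ ℤ.* + d             ≡⟨ cancel (+ d) ⟩
      0ℤ                              ∎
      where
      open ≡-Reasoning
      Σp : ∀ v → sumℤ (λ x → + p v x ℤ.* + 1) ≡ + d
      Σp v = trans (ℤΣ.sum-cong-≗ λ x → ℤₚ.*-identityʳ (+ p v x)) (trans (sym (pos-sum (p v))) (cong +_ (sum-p v)))
      cancel : ∀ b → b ℤ.+ -1ℤ ℤ.* b ≡ 0ℤ
      cancel = solve-∀

    u∙u : ∀ e → u e ∙ u e ≡ + (d + d)
    u∙u e@(y , z , y~z) =
      trans (ℤΣ.sum-cong-≗ λ x → signed-square (x ∈? nb y) (x ∈? nb z) (nb-disjoint y~z x))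
            (trans (sym (pos-sum (s e))) (cong +_ (sum-s e)))

    opaque
      -- Twice the number of edges between the chosen neighbours of y and of z
      g : Edge → ℕ
      g e = sum λ x → sum λ w → a x w * (s e x * s e w)

      g≡ : ∀ e → g e ≡ sum λ x → sum λ w → a x w * (s e x * s e w)
      g≡ e = refl

    uAu : ∀ e → form A (u e) ≡ ℤ.- + g e
    uAu e@(y , z , y~z) = begin
      form A (u e)
        ≡⟨ (∬-cong λ x w → signed-product (adj? G x w) (x ∈? nb y) (x ∈? nb z) (w ∈? nb y) (w ∈? nb z)
             (nb-disjoint y~z x) (nb-disjoint y~z w)
             (λ (x~w , x∈y , w∈y) → triangle-free _ _ _ (nb-adj x∈y , x~w , nb-adj w∈y))
             (λ (x~w , x∈z , w∈z) → triangle-free _ _ _ (nb-adj x∈z , x~w , nb-adj w∈z))) ⟩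
      ∬ (λ x w → -1ℤ ℤ.* + (a x w * (s e x * s e w)))
        ≡⟨ ∬-* -1ℤ (λ x w → + (a x w * (s e x * s e w))) ⟩
      -1ℤ ℤ.* ∬ (λ x w → + (a x w * (s e x * s e w)))
        ≡⟨ cong (-1ℤ ℤ.*_) (trans (ℤΣ.sum-cong-≗ λ x → sym (pos-sum (λ w → a x w * (s e x * s e w))))
                                  (trans (sym (pos-sum (λ x → sum λ w → a x w * (s e x * s e w)))) (cong +_ (sym (g≡ e))))) ⟩
      -1ℤ ℤ.* + g e
        ≡⟨ ℤₚ.-1*i≡-i (+ g e) ⟩
      ℤ.- + g e ∎
      where open ≡-Reasoning

    α : Fin n → Fin n → ℕ
    α y v = sum λ x → p y x * p v x

    α≤d : ∀ y v → α y v ≤ d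
    α≤d y v = ≤-trans (sum-mono λ x → 𝟙*≤ (x ∈? nb y) (p v x)) (≤-reflexive (sum-p v))

    -- The inner product of u e and p v, increased by d to be a natural number
    τ : Edge → Fin n → ℕ
    τ (y , z , _) v = α y v + (d ∸ α z v)

    τ≤2d : ∀ e v → τ e v ≤ d + d
    τ≤2d (y , z , _) v = +-mono-≤ (α≤d y v) (m∸n≤m d (α z v))

    -- The shift by `d` inside `τ` cancels between the two ends of `e′`. Thus ends with nearly equal
    -- `τ e` give a nearly orthogonal `u e′`.
    u∙u′ : ∀ e e′ → u e ∙ u e′ ≡ + τ e (proj₁ e′) ℤ.+ -1ℤ ℤ.* + τ e (proj₁ (proj₂ e′))
    u∙u′ e@(y , z , _) e′@(y′ , z′ , _) = begin
      u e ∙ u e′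
        ≡⟨ (ℤΣ.sum-cong-≗ λ x → ℤₚ.*-comm (u e x) (u e′ x)) ⟩
      sumℤ (λ x → u e′ x ℤ.* u e x)
        ≡⟨ sumℤ-u e′ (u e) ⟩
      sumℤ (λ x → + p y′ x ℤ.* u e x) ℤ.+ -1ℤ ℤ.* sumℤ (λ x → + p z′ x ℤ.* u e x)
        ≡⟨ cong₂ (λ b c → b ℤ.+ -1ℤ ℤ.* c) (test y′) (test z′) ⟩
      (+ τ e y′ ℤ.+ -1ℤ ℤ.* + d) ℤ.+ -1ℤ ℤ.* (+ τ e z′ ℤ.+ -1ℤ ℤ.* + d)
        ≡⟨ cancel (+ τ e y′) (+ τ e z′) (+ d) ⟩
      + τ e y′ ℤ.+ -1ℤ ℤ.* + τ e z′ ∎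
      where
      open ≡-Reasoning
      cancel : ∀ b c d → (b ℤ.+ -1ℤ ℤ.* d) ℤ.+ -1ℤ ℤ.* (c ℤ.+ -1ℤ ℤ.* d) ≡ b ℤ.+ -1ℤ ℤ.* c
      cancel = solve-∀
      pos-α : ∀ y v → sumℤ (λ x → + p y x ℤ.* + p v x) ≡ + α y v
      pos-α y v = trans (ℤΣ.sum-cong-≗ λ x → sym (ℤₚ.pos-* (p y x) (p v x))) (sym (pos-sum (λ x → p y x * p v x)))
      -- With `c ≤ d` the truncated subtraction is a true one.
      shift : ∀ b c d → c ≤ d → + b ℤ.+ -1ℤ ℤ.* + c ≡ + (b + (d ∸ c)) ℤ.+ -1ℤ ℤ.* + d
      shift b c d c≤d with r , refl ← m≤n⇒∃[o]m+o≡n c≤d = trans (eq (+ b) (+ c) (+ r))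
        (cong (λ t → + b ℤ.+ + t ℤ.+ -1ℤ ℤ.* (+ c ℤ.+ + r)) (sym (m+n∸m≡n c r)))
        where
        eq : ∀ b c r → b ℤ.+ -1ℤ ℤ.* c ≡ b ℤ.+ r ℤ.+ -1ℤ ℤ.* (c ℤ.+ r)
        eq = solve-∀
      test : ∀ v → sumℤ (λ x → + p v x ℤ.* u e x) ≡ + τ e v ℤ.+ -1ℤ ℤ.* + d
      test v = begin
        sumℤ (λ x → + p v x ℤ.* u e x)   ≡⟨ (ℤΣ.sum-cong-≗ λ x → ℤₚ.*-comm (+ p v x) (u e x)) ⟩
        sumℤ (λ x → u e x ℤ.* + p v x)   ≡⟨ sumℤ-u e (λ x → + p v x) ⟩
        sumℤ (λ x → + p y x ℤ.* + p v x) ℤ.+ -1ℤ ℤ.* sumℤ (λ x → + p z x ℤ.* + p v x)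
          ≡⟨ cong₂ (λ b c → b ℤ.+ -1ℤ ℤ.* c) (pos-α y v) (pos-α z v) ⟩
        + α y v ℤ.+ -1ℤ ℤ.* + α z v      ≡⟨ shift (α y v) (α z v) d (α≤d z v) ⟩
        + τ e v ℤ.+ -1ℤ ℤ.* + d          ∎

    -- The 2 d vertices in the support of s e have at least 2 d² neighbours with multiplicity,
    -- and each of the n − 2 d other vertices accounts for at most 0.56 n of them;
    -- the terms are moved so that no subtraction occurs.
    few-inside : (∀ v → 1000 * degree G v ≤ 560 * n) → ∀ e →
                 2000 * (d * d) + 1120 * (n * d) ≤ 1000 * g e + 560 * (n * n)
    few-inside Δ≤ e = linear (d * d ∷ n * d ∷ g e ∷ n * n ∷ ΣR ∷ [])
      ( 1000 · 2 ⊛ d² ≼ R by 2d²≤ΣR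
      ∷ 1 · 1000 ⊛ R ⊕ 560 ⊛ (2 ⊛ nd) ≼ 1000 ⊛ γ ⊕ 560 ⊛ n² by inside
      ∷ []) 0 (2000 ⊛ d² ⊕ 1120 ⊛ nd) (1000 ⊛ γ ⊕ 560 ⊛ n²)
      where
      d² nd γ n² R : Lin 5
      d² = var (# 0)
      nd = var (# 1)
      γ = var (# 2)
      n² = var (# 3)
      R = var (# 4)

      R′ : Fin n → ℕ
      R′ w = sum λ x → a x w * s e x

      ΣR : ℕ
      ΣR = sum R′

      2d²≤ΣR : 2 * (d * d) ≤ ΣR
      2d²≤ΣR = begin
        2 * (d * d)        ≡⟨ *-assoc 2 d d ⟨
        2 * d * d          ≡⟨ cong (_* d) (cong (λ t → d + t) (+-identityʳ d)) ⟩
        (d + d) * d        ≡⟨ cong (_* d) (sum-s e) ⟨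
        sum (s e) * d      ≡⟨ *-distribʳ-sum d (s e) ⟩
        sum (λ x → s e x * d) ≤⟨ sum-mono (λ x → *-monoʳ-≤ (s e x) (≤-trans (d≤deg x) (≤-reflexive (deg≡sum x)))) ⟩
        sum (λ x → s e x * sum (a x)) ≡⟨ (sum-cong-≗ λ x → trans (*-distribˡ-sum (s e x) (a x)) (sum-cong-≗ λ w → *-comm (s e x) (a x w))) ⟩
        sum (λ x → sum λ w → a x w * s e x) ≡⟨ ∑-comm (λ x w → a x w * s e x) ⟩
        ΣR                 ∎
        where open ≤-Reasoning

      R′≤deg : ∀ w → R′ w ≤ degree G w
      R′≤deg w = begin
        R′ w      ≤⟨ sum-mono (λ x → ≤-trans (*-monoʳ-≤ (a x w) (s≤1 x)) (≤-reflexive (*-identityʳ (a x w)))) ⟩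
        sum (λ x → a x w) ≡⟨ (sum-cong-≗ λ x → a-sym x w) ⟩
        sum (a w) ≡⟨ deg≡sum w ⟨
        degree G w ∎
        where
        open ≤-Reasoning
        s≤1 : ∀ x → s e x ≤ 1
        s≤1 x with s-01 e x
        ... | inj₁ eq = ≤-trans (≤-reflexive eq) z≤n
        ... | inj₂ eq = ≤-reflexive eq

      pointwise : ∀ w t → t ≡ 0 ⊎ t ≡ 1 → 1000 * R′ w + 560 * n * t ≤ 1000 * (R′ w * t) + 560 * n
      -- Outside the support the degree bound is spent; inside it both sides agree.
      pointwise w _ (inj₁ refl) rewrite *-zeroʳ (560 * n) | *-zeroʳ (R′ w) | +-identityʳ (1000 * R′ w) =
        ≤-trans (*-monoʳ-≤ 1000 (R′≤deg w)) (Δ≤ w)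
      pointwise w _ (inj₂ refl) rewrite *-identityʳ (560 * n) | *-identityʳ (R′ w) = ≤-refl

      inside : 1000 * ΣR + 560 * (2 * (n * d)) ≤ 1000 * g e + 560 * (n * n)
      inside = begin
        1000 * ΣR + 560 * (2 * (n * d))
          ≡⟨ cong₂ _+_ (*-distribˡ-sum 1000 R′) twice ⟩
        sum (λ w → 1000 * R′ w) + sum (λ w → 560 * n * s e w)
          ≡⟨ ∑-distrib-+ (λ w → 1000 * R′ w) (λ w → 560 * n * s e w) ⟨
        sum (λ w → 1000 * R′ w + 560 * n * s e w)
          ≤⟨ sum-mono (λ w → pointwise w (s e w) (s-01 e w)) ⟩
        sum (λ w → 1000 * (R′ w * s e w) + 560 * n)
          ≡⟨ ∑-distrib-+ (λ w → 1000 * (R′ w * s e w)) (λ _ → 560 * n) ⟩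
        sum (λ w → 1000 * (R′ w * s e w)) + sum {n} (λ _ → 560 * n)
          ≡⟨ cong₂ _+_ (sym (*-distribˡ-sum 1000 (λ w → R′ w * s e w))) (sum-const n (560 * n)) ⟩
        1000 * sum (λ w → R′ w * s e w) + n * (560 * n)
          ≡⟨ cong₂ (λ b c → 1000 * b + c) Σ≡g (x∙yz≈y∙xz n 560 n) ⟩
        1000 * g e + 560 * (n * n) ∎
        where
        open ≤-Reasoning
        twice : 560 * (2 * (n * d)) ≡ sum (λ w → 560 * n * s e w)
        twice = begin-equality
          560 * (2 * (n * d)) ≡⟨ cong (560 *_) (x∙yz≈y∙xz 2 n d) ⟩
          560 * (n * (2 * d)) ≡⟨ *-assoc 560 n (2 * d) ⟨
          560 * n * (2 * d)   ≡⟨ cong (560 * n *_) (trans (cong (λ t → d + t) (+-identityʳ d)) (sym (sum-s e))) ⟩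
          560 * n * sum (s e) ≡⟨ *-distribˡ-sum (560 * n) (s e) ⟩
          sum (λ w → 560 * n * s e w) ∎
        Σ≡g : sum (λ w → R′ w * s e w) ≡ g e
        Σ≡g = trans (sum-cong-≗ λ w → trans (*-distribʳ-sum (s e w) (λ x → a x w * s e x))
                                            (sum-cong-≗ λ x → *-assoc (a x w) (s e x) (s e w)))
                    (trans (∑-comm (λ w x → a x w * (s e x * s e w))) (sym (g≡ e)))

  -- Contradiction from 201 successive energy drops.

  module BoundedDegree {n : ℕ} (G : SimpleGraph (Fin n)) (triangle-free : TriangleFree G)
                       (d : ℕ) (d≤deg : ∀ v → d ≤ degree G v)
                       .{{_ : NonZero n}} (12d<5n : 12 * d < 5 * n) (333n≤1000d : 333 * n ≤ 1000 * d)
                       (l : ℕ) (χ≥ : ∀ k → Colorable G k → l ≤ k) (50^<l : ∀ {j} → j ≤ 201 → 50 ^ j < l)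
                       (Δ≤ : ∀ v → 1000 * degree G v ≤ 560 * n) where

    open HighDegree G triangle-free d d≤deg
    open Energy (λ x w → 𝟙 (adj? G x w)) (λ x w → 𝟙-01 (adj? G x w))

    60τ<50n : ∀ e v → 60 * τ e v < 50 * n
    60τ<50n e v = linear (τ e v ∷ d ∷ n ∷ [])
      ( 60 · t ≼ δ ⊕ δ by τ≤2d e v
      ∷ 10 · con 1 ⊕ 12 ⊛ δ ≼ 5 ⊛ ν by 12d<5n
      ∷ []) 0 (con 1 ⊕ 60 ⊛ t) (50 ⊛ ν)
      where
      t δ ν : Lin 3
      t = var (# 0)
      δ = var (# 1)
      ν = var (# 2)

    -- Intervals of length `n / 60`: since `τ ≤ 2 d < 5 n / 6`, fifty of them suffice.
    bucket : Edge → Fin n → Fin 50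
    bucket e v = fromℕ< (m<n*o⇒m/o<n {60 * τ e v} {50} {n} (60τ<50n e v))

    code : ∀ {j} → Vec Edge j → Fin n → Fin (50 ^ j)
    code [] v = zero
    code (e ∷ es) v = combine (bucket e v) (code es v)

    same-bucket : ∀ e (e′ : Edge) → bucket e (proj₁ e′) ≡ bucket e (proj₁ (proj₂ e′)) →
                  60 * ∣ u e ∙ u e′ ∣ ≤ n
    same-bucket e e′@(y , z , _) b≡ = subst (λ i → 60 * ∣ i ∣ ≤ n) (sym (u∙u′ e e′))
      (scaled-∣-∣ 60 n (τ e y) (τ e z) (same-quotient (60 * τ e y) (60 * τ e z) n q≡)
                       (same-quotient (60 * τ e z) (60 * τ e y) n (sym q≡)))
      where
      q≡ : 60 * τ e y / n ≡ 60 * τ e z / n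
      q≡ = fromℕ<-injective _ _ _ _ b≡

    -- Equal codes mean equal buckets for every earlier edge, so each of the `j` squared inner
    -- products is at most `(n / c)²`.
    gram-small : ∀ c {j} (es : Vec Edge j) (e : Edge) →
                 (∀ e₀ → bucket e₀ (proj₁ e) ≡ bucket e₀ (proj₁ (proj₂ e)) → c * ∣ u e₀ ∙ u e ∣ ≤ n) →
                 code es (proj₁ e) ≡ code es (proj₁ (proj₂ e)) → c * c * gram (map u es) (u e) ≤ j * (n * n)
    gram-small c [] e _ _ = ≤-reflexive (trans (cong (c * c *_) (gram-[] (u e))) (*-zeroʳ (c * c)))
    gram-small c {suc j} (e₀ ∷ es) e close eq =
      let b≡ , c≡ = combine-injective (bucket e₀ _) (code es _) (bucket e₀ _) (code es _) eq
          i = ∣ u e₀ ∙ u e ∣ ; Γ = gram (map u es) (u e) in begin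
      c * c * gram (map u (e₀ ∷ es)) (u e) ≡⟨ cong (c * c *_) (gram-∷ (u e₀) (map u es) (u e)) ⟩
      c * c * (Γ + i * i)                  ≡⟨ *-distribˡ-+ (c * c) Γ (i * i) ⟩
      c * c * Γ + c * c * (i * i)          ≤⟨ +-mono-≤ (gram-small c es e close c≡) (square-≤ c n i (close e₀ b≡)) ⟩
      j * (n * n) + n * n                  ≡⟨ +-comm (j * (n * n)) (n * n) ⟩
      n * n + j * (n * n)                  ∎
      where open ≤-Reasoning

    -- Near orthogonality to at most 201 earlier vectors keeps `gram` within `201 n² / 3600`, too
    -- little to offset the gain from `40 g`.
    energy-drop : ∀ {j} (es : Vec Edge j) (e : Edge) → j ≤ 201 →
                  code es (proj₁ e) ≡ code es (proj₁ (proj₂ e)) →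
                  2 * energy (map u (e ∷ es)) + n * n ≤ 2 * energy (map u es)
    energy-drop {j} es e j≤201 eq = drop-arithmetic
      (energy (map u (e ∷ es))) (energy (map u es)) (gram (map u es) (u e)) (g e) (d * d) (n * d) (n * n)
      (≤-reflexive (trans (energy-∷ (map u es) (u e) (sum-u e) (uAu e) (u∙u e))
                          (cong (λ t → energy (map u es) + 2 * gram (map u es) (u e) + t) square)))
      (few-inside Δ≤ e)
      (≤-trans (gram-small 60 es e (λ e₀ → same-bucket e₀ e) eq) (*-monoˡ-≤ (n * n) j≤201))
      (scaled 333 1000 d 333n≤1000d)
      (subst (λ t → 333 * (n * n) ≤ 1000 * t) (*-comm d n) (scaled 333 1000 n 333n≤1000d))
      where
      square : (d + d) * (d + d) ≡ 4 * (d * d)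
      square = trans (cong₂ _*_ 2d 2d) ([m*n]*[o*p]≡[m*o]*[n*p] 2 d 2 d)
        where
        2d : d + d ≡ 2 * d
        2d = cong (λ t → d + t) (sym (+-identityʳ d))

      scaled : ∀ b c m → b * n ≤ c * d → b * (n * m) ≤ c * (d * m)
      scaled b c m bn≤cd = subst₂ _≤_ (*-assoc b n m) (*-assoc c d m) (*-monoˡ-≤ m bn≤cd)

    -- Everything is doubled because one edge lowers the energy by `n² / 2`; the initial energy is
    -- `100 n²`.
    LowEnergy : ℕ → Set
    LowEnergy j = Σ[ es ∈ Vec Edge j ] 2 * energy (map u es) + j * (n * n) ≤ 200 * (n * n)

    low-energy-[] : LowEnergy 0
    low-energy-[] = [] , start (energy []) 100 (trans energy-[] (sym (*-assoc n n 100)))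
      where
      start : ∀ E c → E ≡ n * n * c → 2 * E + 0 ≤ 2 * c * (n * n)
      start _ c refl = ≤-reflexive (trans (+-identityʳ (2 * (n * n * c))) (trans (cong (2 *_) (*-comm (n * n) c)) (sym (*-assoc 2 c (n * n)))))

    low-energy-∷ : ∀ {j} → j ≤ 201 → LowEnergy j → LowEnergy (suc j)
    low-energy-∷ {j} j≤201 (es , bound) with monochromatic-edge {l = l} G χ≥ (50^<l j≤201) (code es)
    ... | y , z , y~z , same = (y , z , y~z) ∷ es ,
      next (energy (map u ((y , z , y~z) ∷ es))) (energy (map u es)) (200 * (n * n))
           (energy-drop es (y , z , y~z) j≤201 same) bound
      where
      next : ∀ E′ E c → 2 * E′ + n * n ≤ 2 * E → 2 * E + j * (n * n) ≤ c → 2 * E′ + suc j * (n * n) ≤ c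
      next E′ E c drop bound = ≤-trans (≤-reflexive (sym (+-assoc (2 * E′) (n * n) (j * (n * n)))))
                                     (≤-trans (+-monoˡ-≤ (j * (n * n)) drop) bound)

    low-energy : ∀ j → j ≤ 201 → LowEnergy j
    low-energy zero _ = low-energy-[]
    low-energy (suc j) j<201 = low-energy-∷ (<⇒≤ j<201) (low-energy j (<⇒≤ j<201))

    -- The energy is nonnegative, so `j n²` alone would have to fit into `200 n²`.
    ¬LowEnergy : ∀ {j} → 200 < j → ¬ LowEnergy j
    ¬LowEnergy {j} 200<j (es , bound) = <⇒≱ (*-monoˡ-< (n * n) {{m*n≢0 n n}} 200<j)
      (≤-trans (m≤n+m (j * (n * n)) (2 * energy (map u es))) bound)

    impossible : ⊥
    impossible = ¬LowEnergy (n<1+n 200) (low-energy 201 ≤-refl)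

-- The three classes determined by a vertex of large degree.

module IndependentSet where

  open import Data.Bool using (T)
  open import Data.Empty using (⊥)
  open import Data.Fin using (Fin; zero; suc; #_; combine)
  open import Data.Fin.Properties using (any?; combine-injective; suc-injective)
  open import Data.Fin.Subset using (Subset; _∈_; ∣_∣)
  open import Data.Fin.Subset.Properties using (p⊆q⇒∣p∣≤∣q∣)
  open import Data.List using ([]; _∷_)
  open import Data.Nat using (ℕ; zero; suc; _+_; _*_; _≤_; _<_; _<ᵇ_; z≤n; s≤s; _≤?_; _<?_)
  open import Data.Nat.Properties hiding (suc-injective)
  open import Data.Product using (_×_; _,_; proj₁; proj₂; ∃-syntax)
  open import Data.Vec using (Vec; []; _∷_)
  open import Data.Vec.Relation.Unary.All using (All; []; _∷_)
  open import Function using (_$_)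
  open import Relation.Binary.PropositionalEquality hiding ([_])
  open import Relation.Nullary using (Dec; yes; no; ¬_; ¬?; contradiction)
  open import Relation.Nullary.Decidable using (_×-dec_; decidable-stable)
  open import Algebra.Properties.CommutativeSemigroup *-commutativeSemigroup using (x∙yz≈y∙xz)
  open LinearArithmetic
  open Counting
  open HighDegreeVertex using (monochromatic-edge)

  three-disjoint-arith : ∀ n d x y z → 1 ≤ n → 333 * n ≤ 1000 * d → 560 * n ≤ 1000 * z → d ≤ x → d ≤ y → x + y + z ≤ n → ⊥
  three-disjoint-arith n d x y z h₀ h₁ h₂ h₃ h₄ h₅ = 1+n≰n {0} $
    linear (n ∷ d ∷ x ∷ y ∷ z ∷ [])
    ( 1 · con 1 ≼ ⟨n⟩ by h₀
    ∷ 2 · 333 ⊛ ⟨n⟩ ≼ 1000 ⊛ ⟨d⟩ by h₁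
    ∷ 1 · 560 ⊛ ⟨n⟩ ≼ 1000 ⊛ ⟨z⟩ by h₂
    ∷ 1000 · ⟨d⟩ ≼ ⟨x⟩ by h₃
    ∷ 1000 · ⟨d⟩ ≼ ⟨y⟩ by h₄
    ∷ 1000 · ⟨x⟩ ⊕ ⟨y⟩ ⊕ ⟨z⟩ ≼ ⟨n⟩ by h₅
    ∷ []) 0 (con 1) (con 0)
    where
    ⟨n⟩ ⟨d⟩ ⟨x⟩ ⟨y⟩ ⟨z⟩ : Lin 5
    ⟨n⟩ = var (# 0)
    ⟨d⟩ = var (# 1)
    ⟨x⟩ = var (# 2)
    ⟨y⟩ = var (# 3)
    ⟨z⟩ = var (# 4)

  -- The hypotheses add up to `5 (2 d + s − n) ≤ 2 s`, that is `10 d + 3 s ≤ 5 n`. But 10 · 0.333 +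
  -- 3 · 0.56 = 5.01, which is why 0.56 is large enough.
  aligned-arith : ∀ n d s v v′ y w w′ c c′ → 1 ≤ n → 333 * n ≤ 1000 * d → 560 * n ≤ 1000 * s →
    2 * d + s ≤ n + v → 2 * d + s ≤ n + v′ → 2 * d + s ≤ n + y → 2 * d + s ≤ n + w → 2 * d + s ≤ n + w′ →
    v + y + w ≤ s + c → v′ + y + w′ ≤ s + c′ → c + c′ ≤ y → ⊥
  aligned-arith n d s v v′ y w w′ c c′ h₀ h₁ h₂ h₃ h₄ h₅ h₆ h₇ h₈ h₉ h₁₀ = 1+n≰n {0} $
    linear (n ∷ d ∷ s ∷ v ∷ v′ ∷ y ∷ w ∷ w′ ∷ c ∷ c′ ∷ [])
    ( 1 · con 1 ≼ ⟨n⟩ by h₀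
    ∷ 10 · 333 ⊛ ⟨n⟩ ≼ 1000 ⊛ ⟨d⟩ by h₁
    ∷ 3 · 560 ⊛ ⟨n⟩ ≼ 1000 ⊛ ⟨s⟩ by h₂
    ∷ 1000 · 2 ⊛ ⟨d⟩ ⊕ ⟨s⟩ ≼ ⟨n⟩ ⊕ ⟨v⟩ by h₃
    ∷ 1000 · 2 ⊛ ⟨d⟩ ⊕ ⟨s⟩ ≼ ⟨n⟩ ⊕ ⟨v′⟩ by h₄
    ∷ 1000 · 2 ⊛ ⟨d⟩ ⊕ ⟨s⟩ ≼ ⟨n⟩ ⊕ ⟨y⟩ by h₅
    ∷ 1000 · 2 ⊛ ⟨d⟩ ⊕ ⟨s⟩ ≼ ⟨n⟩ ⊕ ⟨w⟩ by h₆
    ∷ 1000 · 2 ⊛ ⟨d⟩ ⊕ ⟨s⟩ ≼ ⟨n⟩ ⊕ ⟨w′⟩ by h₇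
    ∷ 1000 · ⟨v⟩ ⊕ ⟨y⟩ ⊕ ⟨w⟩ ≼ ⟨s⟩ ⊕ ⟨c⟩ by h₈
    ∷ 1000 · ⟨v′⟩ ⊕ ⟨y⟩ ⊕ ⟨w′⟩ ≼ ⟨s⟩ ⊕ ⟨c′⟩ by h₉
    ∷ 1000 · ⟨c⟩ ⊕ ⟨c′⟩ ≼ ⟨y⟩ by h₁₀
    ∷ []) 0 (con 1) (con 0)
    where
    ⟨n⟩ ⟨d⟩ ⟨s⟩ ⟨v⟩ ⟨v′⟩ ⟨y⟩ ⟨w⟩ ⟨w′⟩ ⟨c⟩ ⟨c′⟩ : Lin 10
    ⟨n⟩ = var (# 0)
    ⟨d⟩ = var (# 1)
    ⟨s⟩ = var (# 2)
    ⟨v⟩ = var (# 3)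
    ⟨v′⟩ = var (# 4)
    ⟨y⟩ = var (# 5)
    ⟨w⟩ = var (# 6)
    ⟨w′⟩ = var (# 7)
    ⟨c⟩ = var (# 8)
    ⟨c′⟩ = var (# 9)

  heavy-arith : ∀ n d s v v′ → v + v′ ≤ s → 2 * d + s ≤ n + v′ → v + 2 * d ≤ n
  heavy-arith n d s v v′ h₁ h₂ = linear (n ∷ d ∷ s ∷ v ∷ v′ ∷ [])
    ( 1 · ⟨v⟩ ⊕ ⟨v′⟩ ≼ ⟨s⟩ by h₁
    ∷ 1 · 2 ⊛ ⟨d⟩ ⊕ ⟨s⟩ ≼ ⟨n⟩ ⊕ ⟨v′⟩ by h₂
    ∷ []) 0 (⟨v⟩ ⊕ 2 ⊛ ⟨d⟩) ⟨n⟩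
    where
    ⟨n⟩ ⟨d⟩ ⟨s⟩ ⟨v⟩ ⟨v′⟩ : Lin 5
    ⟨n⟩ = var (# 0)
    ⟨d⟩ = var (# 1)
    ⟨s⟩ = var (# 2)
    ⟨v⟩ = var (# 3)
    ⟨v′⟩ = var (# 4)

  -- The last hypothesis reads `s (d − i) ≤ (n − 2 d) a`, where `n − 2 d` is at most `3 s / 5`; then
  -- `s` cancels.
  weighted-arith : ∀ n d s i a → 1 ≤ s → 5 * n ≤ 3 * s + 10 * d → s * d + 2 * d * a ≤ s * i + n * a → 5 * d ≤ 5 * i + 3 * a
  weighted-arith n d s@(suc _) i a _ h₁ h₂ = *-cancelˡ-≤ s (begin
    s * (5 * d)                 ≡⟨ x∙yz≈y∙xz s 5 d ⟩
    5 * (s * d)                 ≤⟨ linear (s * d ∷ d * a ∷ s * i ∷ n * a ∷ s * a ∷ [])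
                                    ( 5 · ⟨sd⟩ ⊕ 2 ⊛ ⟨da⟩ ≼ ⟨si⟩ ⊕ ⟨na⟩ by subst (λ t → s * d + t ≤ s * i + n * a) (*-assoc 2 d a) h₂
                                    ∷ 1 · 5 ⊛ ⟨na⟩ ≼ 3 ⊛ ⟨sa⟩ ⊕ 10 ⊛ ⟨da⟩ by times-a
                                    ∷ []) 0 (5 ⊛ ⟨sd⟩) (5 ⊛ ⟨si⟩ ⊕ 3 ⊛ ⟨sa⟩) ⟩
    5 * (s * i) + 3 * (s * a)   ≡⟨ cong₂ _+_ (x∙yz≈y∙xz 5 s i) (x∙yz≈y∙xz 3 s a) ⟩
    s * (5 * i) + s * (3 * a)   ≡⟨ *-distribˡ-+ s (5 * i) (3 * a) ⟨
    s * (5 * i + 3 * a)         ∎)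
    where
    open ≤-Reasoning
    ⟨sd⟩ ⟨da⟩ ⟨si⟩ ⟨na⟩ ⟨sa⟩ : Lin 5
    ⟨sd⟩ = var (# 0)
    ⟨da⟩ = var (# 1)
    ⟨si⟩ = var (# 2)
    ⟨na⟩ = var (# 3)
    ⟨sa⟩ = var (# 4)
    times-a : 5 * (n * a) ≤ 3 * (s * a) + 10 * (d * a)
    times-a = begin
      5 * (n * a)               ≡⟨ *-assoc 5 n a ⟨
      5 * n * a                 ≤⟨ *-monoˡ-≤ a h₁ ⟩
      (3 * s + 10 * d) * a      ≡⟨ *-distribʳ-+ a (3 * s) (10 * d) ⟩
      3 * s * a + 10 * d * a    ≡⟨ cong₂ _+_ (*-assoc 3 s a) (*-assoc 10 d a) ⟩
      3 * (s * a) + 10 * (d * a) ∎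

  positive-arith : ∀ n s → 1 ≤ n → 560 * n ≤ 1000 * s → 1 ≤ s
  positive-arith n zero 1≤n 560n≤0 = contradiction (≤-trans (*-monoʳ-≤ 560 1≤n) 560n≤0) λ ()
  positive-arith n (suc s) _ _ = s≤s z≤n

  threshold-arith : ∀ n d s → 333 * n ≤ 1000 * d → 560 * n ≤ 1000 * s → 5 * n ≤ 3 * s + 10 * d
  threshold-arith n d s h₁ h₂ = linear (n ∷ d ∷ s ∷ [])
    ( 10 · 333 ⊛ ⟨n⟩ ≼ 1000 ⊛ ⟨d⟩ by h₁
    ∷ 3 · 560 ⊛ ⟨n⟩ ≼ 1000 ⊛ ⟨s⟩ by h₂
    ∷ []) 999 (5 ⊛ ⟨n⟩) (3 ⊛ ⟨s⟩ ⊕ 10 ⊛ ⟨d⟩)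
    where
    ⟨n⟩ ⟨d⟩ ⟨s⟩ : Lin 3
    ⟨n⟩ = var (# 0)
    ⟨d⟩ = var (# 1)
    ⟨s⟩ = var (# 2)

  -- The set `P` and neighbourhoods inside it.

  module Structure {n : ℕ} (G : SimpleGraph (Fin n)) (triangle-free : TriangleFree G)
                   (d : ℕ) (d≤deg : ∀ v → d ≤ degree G v) (333n≤1000d : 333 * n ≤ 1000 * d)
                   (b : Fin n) (560n≤deg : 560 * n ≤ 1000 * degree G b) where

    a : Fin n → Fin n → ℕ
    a x w = 𝟙 (adj? G x w)

    deg≡sum : ∀ v → degree G v ≡ sum (a v)
    deg≡sum v = ∣⟪⟫∣≡sum (adj? G v)

    InP : Fin n → Set
    InP v = ¬ (∃[ x ] (Adj G v x × Adj G b x))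

    inP? : ∀ v → Dec (InP v)
    inP? v = ¬? (any? λ x → adj? G v x ×-dec adj? G b x)

    π : Fin n → ℕ
    π w = 𝟙 (inP? w)

    opaque
      P : Subset n
      P = ⟪ inP? ⟫

      ∈P⁺ : ∀ {v} → InP v → v ∈ P
      ∈P⁺ = ∈⟪⟫⁺ inP?

      ∈P⁻ : ∀ {v} → v ∈ P → InP v
      ∈P⁻ = ∈⟪⟫⁻ inP?

      ∣P∣≡sum : ∣ P ∣ ≡ sum π
      ∣P∣≡sum = ∣⟪⟫∣≡sum inP?

    N[b]⊆P : ∀ {v} → Adj G b v → InP v
    N[b]⊆P b~v (x , v~x , b~x) = triangle-free _ _ _ (b~v , v~x , b~x)

    deg[b]≤∣P∣ : degree G b ≤ ∣ P ∣
    deg[b]≤∣P∣ = p⊆q⇒∣p∣≤∣q∣ λ x∈N → ∈P⁺ (N[b]⊆P (∈⟪⟫⁻ (adj? G b) x∈N))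

    560n≤∣P∣ : 560 * n ≤ 1000 * ∣ P ∣
    560n≤∣P∣ = ≤-trans 560n≤deg (*-monoʳ-≤ 1000 deg[b]≤∣P∣)

    -- If `u` and `v` were adjacent, the neighbourhoods of `u`, `v` and `b` would be pairwise
    -- disjoint, although 2 · 0.333 + 0.56 exceeds 1.
    P-independent : ∀ {u v} → InP u → InP v → ¬ Adj G u v
    P-independent {u} {v} u∈P v∈P u~v =
      three-disjoint-arith n d (degree G u) (degree G v) (degree G b) (Fin⇒1≤ b) 333n≤1000d 560n≤deg (d≤deg u) (d≤deg v) (begin
        degree G u + degree G v + degree G b ≡⟨ cong₂ _+_ (cong₂ _+_ (deg≡sum u) (deg≡sum v)) (deg≡sum b) ⟩
        sum (a u) + sum (a v) + sum (a b)    ≡⟨ sum₃ (a u) (a v) (a b) ⟨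
        sum (λ w → a u w + a v w + a b w)    ≤⟨ sum-mono at-most-one ⟩
        sum {n} (λ _ → 1)                    ≡⟨ sum-1 n ⟩
        n                                    ∎)
      where
      open ≤-Reasoning
      at-most-one : ∀ w → a u w + a v w + a b w ≤ 1
      at-most-one w with adj? G u w | adj? G v w | adj? G b w
      ... | yes u~w | yes v~w | _ = contradiction (u~v , v~w , u~w) (triangle-free _ _ _)
      ... | yes u~w | no _ | yes b~w = contradiction (w , u~w , b~w) u∈P
      ... | no _ | yes v~w | yes b~w = contradiction (w , v~w , b~w) v∈P
      ... | yes _ | no _ | no _ = ≤-refl
      ... | no _ | yes _ | no _ = ≤-refl
      ... | no _ | no _ | yes _ = ≤-refl
      ... | no _ | no _ | no _ = z≤n

    deg+∣P∣≤n : ∀ {x} → InP x → degree G x + ∣ P ∣ ≤ n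
    deg+∣P∣≤n {x} x∈P = begin
      degree G x + ∣ P ∣         ≡⟨ cong₂ _+_ (deg≡sum x) ∣P∣≡sum ⟩
      sum (a x) + sum π          ≡⟨ ∑-distrib-+ (a x) π ⟨
      sum (λ w → a x w + π w)    ≤⟨ sum-mono (λ w → count-exclusive₂ (adj? G x w) (inP? w) λ (x~w , w∈P) → P-independent x∈P w∈P x~w) ⟩
      sum {n} (λ _ → 1)          ≡⟨ sum-1 n ⟩
      n                          ∎
      where open ≤-Reasoning

    opaque
      E : Fin n → ℕ
      E v = sum λ w → a v w * π w

      E≡ : ∀ v → E v ≡ sum λ w → a v w * π w
      E≡ v = refl

      E≤∣P∣ : ∀ v → E v ≤ ∣ P ∣
      E≤∣P∣ v = ≤-trans (sum-mono λ w → 𝟙*≤ (adj? G v w) (π w)) (≤-reflexive (sym ∣P∣≡sum))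

      -- A common neighbour `x` of `v` and `b` lies in `P`, so `N(x)` avoids both `N(v)` and `P`. In
      -- the sum of the three sizes only `N(v) ∩ P` is counted twice.
      E-lower : ∀ {v} → ¬ InP v → 2 * d + ∣ P ∣ ≤ n + E v
      E-lower {v} v∉P with decidable-stable (any? λ x → adj? G v x ×-dec adj? G b x) v∉P
      ... | x , v~x , b~x = begin
        2 * d + ∣ P ∣                       ≡⟨ cong (λ t → d + t + ∣ P ∣) (+-identityʳ d) ⟩
        d + d + ∣ P ∣                       ≤⟨ +-mono-≤ (+-mono-≤ (d≤deg v) (d≤deg x)) (≤-refl {∣ P ∣}) ⟩
        degree G v + degree G x + ∣ P ∣     ≡⟨ cong₂ _+_ (cong₂ _+_ (deg≡sum v) (deg≡sum x)) ∣P∣≡sum ⟩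
        sum (a v) + sum (a x) + sum π       ≡⟨ sum₃ (a v) (a x) π ⟨
        sum (λ w → a v w + a x w + π w)     ≤⟨ sum-mono (λ w → count-exclusive₃ (adj? G v w) (adj? G x w) (inP? w)
                                                 (λ (v~w , x~w) → triangle-free _ _ _ (v~x , x~w , v~w))
                                                 (λ (x~w , w∈P) → P-independent (N[b]⊆P b~x) w∈P x~w)) ⟩
        sum (λ w → 1 + a v w * π w)         ≡⟨ ∑-distrib-+ (λ _ → 1) (λ w → a v w * π w) ⟩
        sum {n} (λ _ → 1) + E v             ≡⟨ cong (_+ E v) (sum-1 n) ⟩
        n + E v                             ∎
        where open ≤-Reasoning

      E-adjacent : ∀ {v v′} → Adj G v v′ → E v + E v′ ≤ ∣ P ∣
      E-adjacent {v} {v′} v~v′ = begin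
        E v + E v′                              ≡⟨ ∑-distrib-+ (λ w → a v w * π w) (λ w → a v′ w * π w) ⟨
        sum (λ w → a v w * π w + a v′ w * π w)  ≤⟨ sum-mono (λ w → count-within₂ (adj? G v w) (adj? G v′ w) (inP? w)
                                                     λ (v~w , v′~w) → triangle-free _ _ _ (v~v′ , v′~w , v~w)) ⟩
        sum π                                   ≡⟨ ∣P∣≡sum ⟨
        ∣ P ∣                                   ∎
        where open ≤-Reasoning

      C : Fin n → Fin n → ℕ
      C v y = sum λ x → a v x * a y x * π x

      -- `N(w)` avoids `N(v)` and `N(y)`, so within `P` only the common neighbours of `v` and `y`
      -- are counted twice.
      E-path : ∀ {v y w} → Adj G w v → Adj G w y → E v + E y + E w ≤ ∣ P ∣ + C v y
      E-path {v} {y} {w} w~v w~y = begin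
        E v + E y + E w          ≡⟨ sum₃ (λ x → a v x * π x) (λ x → a y x * π x) (λ x → a w x * π x) ⟨
        sum (λ x → a v x * π x + a y x * π x + a w x * π x)
          ≤⟨ sum-mono (λ x → count-within₃ (adj? G v x) (adj? G y x) (adj? G w x) (inP? x)
               (λ (v~x , w~x) → triangle-free _ _ _ (w~v , v~x , w~x))
               (λ (y~x , w~x) → triangle-free _ _ _ (w~y , y~x , w~x))) ⟩
        sum (λ x → π x + a v x * a y x * π x) ≡⟨ ∑-distrib-+ π (λ x → a v x * a y x * π x) ⟩
        sum π + C v y            ≡⟨ cong (_+ C v y) ∣P∣≡sum ⟨
        ∣ P ∣ + C v y            ∎
        where open ≤-Reasoning

      C-adjacent : ∀ {v v′} y → Adj G v v′ → C v y + C v′ y ≤ E y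
      C-adjacent {v} {v′} y v~v′ = begin
        C v y + C v′ y ≡⟨ ∑-distrib-+ (λ x → a v x * a y x * π x) (λ x → a v′ x * a y x * π x) ⟨
        sum (λ x → a v x * a y x * π x + a v′ x * a y x * π x) ≤⟨ sum-mono within ⟩
        E y            ∎
        where
        open ≤-Reasoning
        within : ∀ x → a v x * a y x * π x + a v′ x * a y x * π x ≤ a y x * π x
        within x = begin
          a v x * a y x * π x + a v′ x * a y x * π x ≡⟨ *-distribʳ-+ (π x) (a v x * a y x) (a v′ x * a y x) ⟨
          (a v x * a y x + a v′ x * a y x) * π x     ≤⟨ *-monoˡ-≤ (π x) (count-within₂ (adj? G v x) (adj? G v′ x) (adj? G y x)
                                                          λ (v~x , v′~x) → triangle-free _ _ _ (v~v′ , v′~x , v~x)) ⟩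
          a y x * π x                                ∎

    -- Since E is at least 2 d + ∣ P ∣ − n outside P, exceeding n − 2 d is exactly what makes
    -- a vertex share a neighbour in P with every other vertex outside P.
    Heavy Light : Fin n → Set
    Heavy v = ¬ InP v × n < E v + 2 * d
    Light v = ¬ InP v × E v + 2 * d ≤ n

    heavy? : ∀ v → Dec (Heavy v)
    heavy? v = ¬? (inP? v) ×-dec n <? E v + 2 * d

    light? : ∀ v → Dec (Light v)
    light? v = ¬? (inP? v) ×-dec E v + 2 * d ≤? n

    -- Adjacent vertices share no neighbour in `P`, and `v′` already takes `2 d + ∣ P ∣ − n` of its
    -- elements; at most `n − 2 d` are left for `v`.
    heavy-isolated : ∀ {v v′} → Heavy v → ¬ InP v′ → ¬ Adj G v v′
    heavy-isolated {v} {v′} (_ , n<) v′∉P v~v′ =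
      <⇒≱ n< (heavy-arith n d (∣ P ∣) (E v) (E v′) (E-adjacent v~v′) (E-lower v′∉P))

    -- For a fixed light `y`, the light vertices close to `y` turn out to be independent, so
    -- closeness can serve as a colour.
    Close : Fin n → Fin n → Set
    Close v y = ∃[ w ] (Light w × Adj G w v × Adj G w y)

    close? : ∀ v y → Dec (Close v y)
    close? v y = any? λ w → light? w ×-dec adj? G w v ×-dec adj? G w y

    -- Two disjoint sets of common neighbours with y fit into N(y) ∩ P, and each is large:
    -- this would give 5 (2 d + ∣ P ∣ − n) ≤ 2 ∣ P ∣.
    close-independent : ∀ {v v′ y} → Light v → Light v′ → Light y → Close v y → Close v′ y → ¬ Adj G v v′
    close-independent {v} {v′} {y} (v∉P , _) (v′∉P , _) (y∉P , _) (w , (w∉P , _) , w~v , w~y) (w′ , (w′∉P , _) , w′~v′ , w′~y) v~v′ =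
      aligned-arith n d (∣ P ∣) (E v) (E v′) (E y) (E w) (E w′) (C v y) (C v′ y)
        (Fin⇒1≤ b) 333n≤1000d 560n≤∣P∣ (E-lower v∉P) (E-lower v′∉P) (E-lower y∉P) (E-lower w∉P) (E-lower w′∉P)
        (E-path w~v w~y) (E-path w′~v′ w′~y) (C-adjacent y v~v′)

    data Class (v : Fin n) : Set where
      inP : InP v → Class v
      heavy : Heavy v → Class v
      light : Light v → Class v

    classify : ∀ v → Class v
    classify v with inP? v
    ... | yes v∈P = inP v∈P
    ... | no v∉P with E v + 2 * d ≤? n
    ... | yes ≤n = light (v∉P , ≤n)
    ... | no ≰n = heavy (v∉P , ≰⇒> ≰n)

  -- Spread edges and the sizes of the classes.

  module Sizes {n : ℕ} (G : SimpleGraph (Fin n)) (triangle-free : TriangleFree G)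
               (d : ℕ) (d≤deg : ∀ v → d ≤ degree G v) (333n≤1000d : 333 * n ≤ 1000 * d)
               (b : Fin n) (560n≤deg : 560 * n ≤ 1000 * degree G b)
               (l : ℕ) (χ≥ : ∀ k → Colorable G k → l ≤ k) (27<l : 27 < l) where

    open Structure G triangle-free d d≤deg 333n≤1000d b 560n≤deg

    -- The first two classes are independent, so a monochromatic edge has light ends.
    region : Fin n → Fin 3
    region v with classify v
    ... | inP _ = zero
    ... | heavy _ = suc zero
    ... | light _ = suc (suc zero)

    adjacent-same-region : ∀ {u v} → Adj G u v → region u ≡ region v → Light u × Light v
    adjacent-same-region {u} {v} u~v eq with classify u | classify v
    ... | inP u∈P | inP v∈P = contradiction u~v (P-independent u∈P v∈P)
    ... | heavy hu | heavy (v∉P , _) = contradiction u~v (heavy-isolated hu v∉P)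
    ... | light lu | light lv = lu , lv

    -- The position of the first listed vertex to which `v` is close, and the last value if there is
    -- none. An edge between light vertices can be monochromatic only with that last value.
    closeIndex : ∀ {m} → Vec (Fin n) m → Fin n → Fin (suc m)
    closeIndex [] v = zero
    closeIndex (y ∷ ys) v with close? v y
    ... | yes _ = zero
    ... | no _ = suc (closeIndex ys v)

    NotClose : Fin n → Fin n → Set
    NotClose v y = ¬ Close v y

    same-closeIndex : ∀ {m u v} (ys : Vec (Fin n) m) → All Light ys → Light u → Light v → Adj G u v →
                      closeIndex ys u ≡ closeIndex ys v → All (NotClose u) ys × All (NotClose v) ys
    same-closeIndex [] _ _ _ _ _ = [] , []
    same-closeIndex {u = u} {v} (y ∷ ys) (ly ∷ lys) lu lv u~v eq with close? u y | close? v y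
    ... | yes uy | yes vy = contradiction u~v (close-independent lu lv ly uy vy)
    ... | no ¬uy | no ¬vy =
      let us , vs = same-closeIndex ys lys lu lv u~v (suc-injective eq) in ¬uy ∷ us , ¬vy ∷ vs

    cnt : ∀ {m} → Vec (Fin n) m → Fin n → ℕ
    cnt [] w = 0
    cnt (y ∷ ys) w = a y w + cnt ys w

    cnt-not-close : ∀ {m v w} (ys : Vec (Fin n) m) → Light w → Adj G v w → All (NotClose v) ys → cnt ys w ≡ 0
    cnt-not-close [] _ _ [] = refl
    cnt-not-close {w = w} (y ∷ ys) lw v~w (¬vy ∷ ¬vys) = cong₂ _+_
      (count-no (adj? G y w) λ y~w → ¬vy (w , lw , symm G v~w , symm G y~w)) (cnt-not-close ys lw v~w ¬vys)

    cnt-heavy : ∀ {m w} (ys : Vec (Fin n) m) → Heavy w → All Light ys → cnt ys w ≡ 0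
    cnt-heavy [] _ [] = refl
    cnt-heavy {w = w} (y ∷ ys) hw ((y∉P , _) ∷ lys) = cong₂ _+_
      (count-no (adj? G y w) λ y~w → heavy-isolated hw y∉P (symm G y~w)) (cnt-heavy ys hw lys)

    sum-cnt : ∀ {m} (ys : Vec (Fin n) m) → m * d ≤ sum (cnt ys)
    sum-cnt [] = z≤n
    sum-cnt (y ∷ ys) = ≤-trans (+-mono-≤ (≤-trans (d≤deg y) (≤-reflexive (deg≡sum y))) (sum-cnt ys))
                               (≤-reflexive (sym (∑-distrib-+ (a y) (cnt ys))))

    -- ends lists the ends of j edges, two by two; cnt counts the neighbours among them.
    record Spread (j : ℕ) : Set where
      field
        ends : Vec (Fin n) (j * 2)
        ends-light : All Light ends
        cnt≤j : ∀ w → cnt ends w ≤ j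
        cnt≤1 : ∀ {w} → Light w → cnt ends w ≤ 1

    spread-[] : Spread 0
    spread-[] = record { ends = [] ; ends-light = [] ; cnt≤j = λ _ → z≤n ; cnt≤1 = λ _ → z≤n }

    -- The ends of the new edge are light and close to no earlier end. So a light vertex adjacent to
    -- a new end is adjacent to no earlier one, and triangle-freeness keeps it from the other new
    -- end.
    spread-∷ : ∀ {j} → 3 * suc (j * 2) < l → Spread j → Spread (suc j)
    spread-∷ {j} few sp with monochromatic-edge {l = l} G χ≥ few (λ v → combine (region v) (closeIndex (Spread.ends sp) v))
    ... | y , z , y~z , same = record
      { ends = y ∷ z ∷ ends ; ends-light = ly ∷ lz ∷ ends-light ; cnt≤j = cnt≤j′ ; cnt≤1 = cnt≤1′ }
      where
      open Spread sp
      same₂ = combine-injective (region y) (closeIndex ends y) (region z) (closeIndex ends z) same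
      lights : Light y × Light z
      lights = adjacent-same-region y~z (proj₁ same₂)
      ly = proj₁ lights
      lz = proj₂ lights
      ¬close = same-closeIndex ends ends-light ly lz y~z (proj₂ same₂)

      y-or-z : ∀ w → a y w + a z w ≤ 1
      y-or-z w = count-exclusive₂ (adj? G y w) (adj? G z w) λ (y~w , z~w) → triangle-free _ _ _ (y~z , z~w , y~w)

      cnt≤j′ : ∀ w → a y w + (a z w + cnt ends w) ≤ suc j
      cnt≤j′ w = ≤-trans (≤-reflexive (sym (+-assoc (a y w) (a z w) (cnt ends w)))) (+-mono-≤ (y-or-z w) (cnt≤j w))

      cnt≤1′ : ∀ {w} → Light w → a y w + (a z w + cnt ends w) ≤ 1
      cnt≤1′ {w} lw = ≤-trans (≤-reflexive (sym (+-assoc (a y w) (a z w) (cnt ends w)))) bound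
        where
        old-missed : cnt ends w ≡ 0 → a y w + a z w + cnt ends w ≤ 1
        old-missed eq = ≤-trans (≤-reflexive (trans (cong (λ t → a y w + a z w + t) eq) (+-identityʳ _))) (y-or-z w)
        bound : a y w + a z w + cnt ends w ≤ 1
        bound with adj? G y w | adj? G z w | old-missed
        ... | yes y~w | _ | missed = missed (cnt-not-close ends lw y~w (proj₁ ¬close))
        ... | no _ | yes z~w | missed = missed (cnt-not-close ends lw z~w (proj₂ ¬close))
        ... | no _ | no _ | _ = cnt≤1 lw

    spread-4 : Spread 4
    -- The numbers of colours `3 * suc (j * 2)` are 21, 15, 9 and 3.
    spread-4 = spread-∷ (lt 20) (spread-∷ (lt 14) (spread-∷ (lt 8) (spread-∷ (lt 2) spread-[])))
      where
      lt : ∀ m {_ : T (m <ᵇ 27)} → suc m < l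
      lt m {m<27} = ≤-trans (s≤s (<ᵇ⇒< m 27 m<27)) 27<l

    ι α : Fin n → ℕ
    ι w = 𝟙 (heavy? w)
    α w = 𝟙 (light? w)

    opaque
      I₂ A : Subset n
      I₂ = ⟪ heavy? ⟫
      A = ⟪ light? ⟫

      ∈I₂⁺ : ∀ {v} → Heavy v → v ∈ I₂
      ∈I₂⁺ = ∈⟪⟫⁺ heavy?

      ∈I₂⁻ : ∀ {v} → v ∈ I₂ → Heavy v
      ∈I₂⁻ = ∈⟪⟫⁻ heavy?

      ∣I₂∣≡sum : ∣ I₂ ∣ ≡ sum ι
      ∣I₂∣≡sum = ∣⟪⟫∣≡sum heavy?

      ∈A⁺ : ∀ {v} → Light v → v ∈ A
      ∈A⁺ = ∈⟪⟫⁺ light?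

      ∈A⁻ : ∀ {v} → v ∈ A → Light v
      ∈A⁻ = ∈⟪⟫⁻ light?

      ∣A∣≡sum : ∣ A ∣ ≡ sum α
      ∣A∣≡sum = ∣⟪⟫∣≡sum light?

    heavy⇒¬light : ∀ {v} → Heavy v → ¬ Light v
    heavy⇒¬light (_ , n<) (_ , ≤n) = <⇒≱ n< ≤n

    π-ι-α : ∀ w → π w + ι w + α w ≡ 1
    π-ι-α w with classify w
    ... | inP w∈P = cong₂ _+_ (cong₂ _+_ (count-yes (inP? w) w∈P) (count-no (heavy? w) λ h → proj₁ h w∈P))
                              (count-no (light? w) λ h → proj₁ h w∈P)
    ... | heavy h = cong₂ _+_ (cong₂ _+_ (count-no (inP? w) (proj₁ h)) (count-yes (heavy? w) h))
                              (count-no (light? w) (heavy⇒¬light h))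
    ... | light h = cong₂ _+_ (cong₂ _+_ (count-no (inP? w) (proj₁ h)) (count-no (heavy? w) λ h′ → heavy⇒¬light h′ h))
                              (count-yes (light? w) h)

    partition-size : ∣ P ∣ + ∣ I₂ ∣ + ∣ A ∣ ≡ n
    partition-size = begin
      ∣ P ∣ + ∣ I₂ ∣ + ∣ A ∣        ≡⟨ cong₂ _+_ (cong₂ _+_ ∣P∣≡sum ∣I₂∣≡sum) ∣A∣≡sum ⟩
      sum π + sum ι + sum α         ≡⟨ sum₃ π ι α ⟨
      sum (λ w → π w + ι w + α w)   ≡⟨ sum-cong-≗ π-ι-α ⟩
      sum {n} (λ _ → 1)             ≡⟨ sum-1 n ⟩
      n                             ∎
      where open ≡-Reasoning

    -- The degrees of the `2 j` ends, summed over their neighbours: a vertex of `P` is counted at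
    -- most `j` times, a light one at most once, a heavy one never.
    spread-size : ∀ {j} → Spread j → j * 2 * d ≤ j * ∣ P ∣ + ∣ A ∣
    spread-size {j} sp = begin
      j * 2 * d                     ≤⟨ sum-cnt ends ⟩
      sum (cnt ends)                ≤⟨ sum-mono pointwise ⟩
      sum (λ w → j * π w + α w)     ≡⟨ ∑-distrib-+ (λ w → j * π w) α ⟩
      sum (λ w → j * π w) + sum α   ≡⟨ cong₂ _+_ (trans (cong (j *_) ∣P∣≡sum) (*-distribˡ-sum j π)) ∣A∣≡sum ⟨
      j * ∣ P ∣ + ∣ A ∣             ∎
      where
      open ≤-Reasoning
      open Spread sp
      pointwise : ∀ w → cnt ends w ≤ j * π w + α w
      pointwise w with classify w
      ... | inP w∈P rewrite count-yes (inP? w) w∈P | *-identityʳ j = ≤-trans (cnt≤j w) (m≤m+n j _)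
      ... | heavy h = ≤-trans (≤-reflexive (cnt-heavy ends h ends-light)) z≤n
      ... | light h rewrite count-yes (light? w) h = ≤-trans (cnt≤1 h) (m≤n+m 1 (j * π w))

    8d≤4∣P∣+∣A∣ : 8 * d ≤ 4 * ∣ P ∣ + ∣ A ∣
    8d≤4∣P∣+∣A∣ = spread-size spread-4

    E-inP : ∀ {w} → InP w → E w ≡ 0
    E-inP {w} w∈P = n≤0⇒n≡0 (begin
      E w                         ≡⟨ E≡ w ⟩
      sum (λ x → a w x * π x)     ≤⟨ sum-mono none ⟩
      sum {n} (λ _ → 0)           ≡⟨ trans (sum-const n 0) (*-zeroʳ n) ⟩
      0                           ∎)
      where
      open ≤-Reasoning
      none : ∀ x → a w x * π x ≤ 0
      none x = ≤-reflexive (count-both-no (adj? G w x) (inP? x) λ (w~x , x∈P) → P-independent w∈P x∈P w~x)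

    -- The edges leaving `P`, counted twice: at least `d` at each vertex of `P`, at most `∣ P ∣` at
    -- a heavy vertex and `n − 2 d` at a light one. The term with `2 d` is moved to the left.
    P-degrees : ∣ P ∣ * d + 2 * d * ∣ A ∣ ≤ ∣ P ∣ * ∣ I₂ ∣ + n * ∣ A ∣
    P-degrees = begin
      ∣ P ∣ * d + 2 * d * ∣ A ∣
        ≡⟨ cong₂ _+_ (trans (cong (_* d) ∣P∣≡sum) (*-distribʳ-sum d π)) (trans (cong (2 * d *_) ∣A∣≡sum) (*-distribˡ-sum (2 * d) α)) ⟩
      sum (λ x → π x * d) + sum (λ w → 2 * d * α w)
        ≤⟨ +-monoˡ-≤ _ (sum-mono λ x → *-monoʳ-≤ (π x) (≤-trans (d≤deg x) (≤-reflexive (deg≡sum x)))) ⟩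
      sum (λ x → π x * sum (a x)) + sum (λ w → 2 * d * α w)
        ≡⟨ cong (_+ sum (λ w → 2 * d * α w)) double-count ⟩
      sum E + sum (λ w → 2 * d * α w)
        ≡⟨ ∑-distrib-+ E (λ w → 2 * d * α w) ⟨
      sum (λ w → E w + 2 * d * α w)
        ≤⟨ sum-mono pointwise ⟩
      sum (λ w → ∣ P ∣ * ι w + n * α w)
        ≡⟨ ∑-distrib-+ (λ w → ∣ P ∣ * ι w) (λ w → n * α w) ⟩
      sum (λ w → ∣ P ∣ * ι w) + sum (λ w → n * α w)
        ≡⟨ cong₂ _+_ (trans (cong (∣ P ∣ *_) ∣I₂∣≡sum) (*-distribˡ-sum (∣ P ∣) ι)) (trans (cong (n *_) ∣A∣≡sum) (*-distribˡ-sum n α)) ⟨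
      ∣ P ∣ * ∣ I₂ ∣ + n * ∣ A ∣ ∎
      where
      open ≤-Reasoning
      double-count : sum (λ x → π x * sum (a x)) ≡ sum E
      double-count = trans (sum-cong-≗ λ x → *-distribˡ-sum (π x) (a x))
        (trans (∑-comm (λ x w → π x * a x w))
               (sum-cong-≗ λ w → trans (sum-cong-≗ λ x → trans (*-comm (π x) (a x w))
                  (cong (_* π x) (𝟙-⇔ (adj? G x w) (adj? G w x) (symm G) (symm G)))) (sym (E≡ w))))
      at-P : ∀ e s i m {t} → e ≡ 0 → t ≡ 0 → e + 2 * d * t ≤ s * i + m * t
      at-P _ s i m refl refl = ≤-trans (≤-reflexive (*-zeroʳ (2 * d))) z≤n
      at-I₂ : ∀ e s m D {i t} → e ≤ s → i ≡ 1 → t ≡ 0 → e + D * t ≤ s * i + m * t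
      at-I₂ e s m D e≤s refl refl = +-mono-≤ (≤-trans e≤s (≤-reflexive (sym (*-identityʳ s)))) (≤-trans (≤-reflexive (*-zeroʳ D)) z≤n)
      at-A : ∀ e m D k {t} → e + D ≤ m → t ≡ 1 → e + D * t ≤ k + m * t
      at-A e m D k e+D≤m refl = ≤-trans (≤-trans (+-monoʳ-≤ e (≤-reflexive (*-identityʳ D))) (≤-trans e+D≤m (≤-reflexive (sym (*-identityʳ m))))) (m≤n+m (m * 1) k)
      pointwise : ∀ w → E w + 2 * d * α w ≤ ∣ P ∣ * ι w + n * α w
      pointwise w with classify w
      ... | inP w∈P = at-P (E w) (∣ P ∣) (ι w) n (E-inP w∈P) (count-no (light? w) λ h → proj₁ h w∈P)
      ... | heavy h = at-I₂ (E w) (∣ P ∣) n (2 * d) (E≤∣P∣ w) (count-yes (heavy? w) h) (count-no (light? w) (heavy⇒¬light h))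
      ... | light h = at-A (E w) n (2 * d) (∣ P ∣ * ι w) (proj₂ h) (count-yes (light? w) h)

    5d≤5∣I₂∣+3∣A∣ : 5 * d ≤ 5 * ∣ I₂ ∣ + 3 * ∣ A ∣
    5d≤5∣I₂∣+3∣A∣ = weighted-arith n d (∣ P ∣) (∣ I₂ ∣) (∣ A ∣)
      (positive-arith n (∣ P ∣) (Fin⇒1≤ b) 560n≤∣P∣) (threshold-arith n d (∣ P ∣) 333n≤1000d 560n≤∣P∣) P-degrees

    -- A light vertex has no heavy neighbour.
    deg≤E+∣A∣ : ∀ {v} → Light v → degree G v ≤ E v + ∣ A ∣
    deg≤E+∣A∣ {v} lv = begin
      degree G v                        ≡⟨ deg≡sum v ⟩
      sum (a v)                         ≤⟨ sum-mono pointwise ⟩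
      sum (λ w → a v w * π w + α w)     ≡⟨ ∑-distrib-+ (λ w → a v w * π w) α ⟩
      sum (λ w → a v w * π w) + sum α   ≡⟨ cong₂ _+_ (E≡ v) ∣A∣≡sum ⟨
      E v + ∣ A ∣                       ∎
      where
      open ≤-Reasoning
      pointwise : ∀ w → a v w ≤ a v w * π w + α w
      pointwise w with classify w
      ... | inP w∈P rewrite count-yes (inP? w) w∈P | *-identityʳ (a v w) = m≤m+n _ _
      ... | heavy h = ≤-trans (≤-reflexive (count-no (adj? G v w) λ v~w → heavy-isolated h (proj₁ lv) (symm G v~w))) z≤n
      ... | light h rewrite count-yes (light? w) h = ≤-trans (≤-trans (≤-reflexive (sym (*-identityʳ (a v w)))) (𝟙*≤ (adj? G v w) 1)) (m≤n+m 1 _)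

open import Data.Empty using (⊥-elim)
open import Data.Fin using (Fin; zero; suc; #_)
open import Data.Fin.Properties using (any?)
open import Data.Fin.Subset using (Subset; _∈_; _⊆_; _∪_; _∩_; ∣_∣; Empty; Nonempty; ⊤)
open import Data.Fin.Subset.Properties using (⊆-antisym; ⊆⊤; x∈p∪q⁺; x∈p∩q⁻)
open import Data.Integer as ℤ using (+_)
import Data.Integer.Properties as ℤₚ
open import Data.Integer.Tactic.RingSolver using (solve-∀)
open import Data.List using ([]; _∷_)
open import Data.Nat using (ℕ; zero; suc; _+_; _*_; _≤_; _<_; _∸_; z≤n; s≤s; s≤s⁻¹; NonZero; _^_; _<?_; >-nonZero; >-nonZero⁻¹)
open import Data.Nat.Properties
open import Data.Nat.DivMod using (_/_; _%_; m≡m%n+[m/n]*n; m%n<n; m<n*o⇒m/o<n; m/n*n≤m)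
open import Data.Product using (_×_; _,_; proj₁; proj₂; ∃-syntax; Σ-syntax)
open import Data.Rational.Unnormalised as ℚ using (*≤*; *<*)
open import Data.Sum using (inj₁; inj₂)
open import Data.Unit using (tt)
open import Data.Vec using (Vec; []; _∷_)
open import Function using (id)
open import Relation.Binary.PropositionalEquality hiding ([_])
open import Relation.Nullary using (Dec; yes; no)
open import Relation.Nullary.Decidable using (_×-dec_)
open LinearArithmetic
open Counting
open HighDegreeVertex
open IndependentSet

-- Rational bounds and rounding in terms of natural numbers.

module _ (k n m s : ℕ) where
  private
    -- The left side is what cross-multiplying the unnormalised fractions produces.
    expand : ∀ k n m → ((k ℤ.* n) ℤ.* + 1 ℤ.+ (ℤ.- m) ℤ.* + 3) ℤ.* + 1 ≡ k ℤ.* n ℤ.- + 3 ℤ.* m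
    expand = solve-∀
    cancel : ∀ s m → + 3 ℤ.* s ℤ.+ + 3 ℤ.* m ℤ.- + 3 ℤ.* m ≡ s ℤ.* + 3
    cancel = solve-∀
    uncancel : ∀ k n m → k ℤ.* n ℤ.- + 3 ℤ.* m ℤ.+ + 3 ℤ.* m ≡ k ℤ.* n
    uncancel = solve-∀
    pos : + (3 * s + 3 * m) ≡ + 3 ℤ.* + s ℤ.+ + 3 ℤ.* + m
    pos = cong₂ ℤ._+_ (ℤₚ.pos-* 3 s) (ℤₚ.pos-* 3 m)

  thirds-≤⁺ : k * n ≤ 3 * s + 3 * m → (+ k ℚ./ 3) ℚ.* fromℕ n ℚ.- fromℕ m ℚ.≤ fromℕ s
  thirds-≤⁺ kn≤ = *≤* (begin
    ((+ k ℤ.* + n) ℤ.* + 1 ℤ.+ (ℤ.- + m) ℤ.* + 3) ℤ.* + 1 ≡⟨ expand (+ k) (+ n) (+ m) ⟩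
    + k ℤ.* + n ℤ.- + 3 ℤ.* + m                 ≡⟨ cong (ℤ._- + 3 ℤ.* + m) (ℤₚ.pos-* k n) ⟨
    + (k * n) ℤ.- + 3 ℤ.* + m                   ≤⟨ ℤₚ.+-monoˡ-≤ (ℤ.- (+ 3 ℤ.* + m)) (ℤ.+≤+ kn≤) ⟩
    + (3 * s + 3 * m) ℤ.- + 3 ℤ.* + m           ≡⟨ cong (ℤ._- + 3 ℤ.* + m) pos ⟩
    + 3 ℤ.* + s ℤ.+ + 3 ℤ.* + m ℤ.- + 3 ℤ.* + m ≡⟨ cancel (+ s) (+ m) ⟩
    + s ℤ.* + 3                                 ∎)
    where open ℤₚ.≤-Reasoning

  thirds-≤⁻ : (+ k ℚ./ 3) ℚ.* fromℕ n ℚ.- fromℕ m ℚ.≤ fromℕ s → k * n ≤ 3 * s + 3 * m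
  thirds-≤⁻ (*≤* h) = ℤ.drop‿+≤+ (begin
    + (k * n)                                      ≡⟨ ℤₚ.pos-* k n ⟩
    + k ℤ.* + n                                    ≡⟨ uncancel (+ k) (+ n) (+ m) ⟨
    + k ℤ.* + n ℤ.- + 3 ℤ.* + m ℤ.+ + 3 ℤ.* + m    ≡⟨ cong (ℤ._+ + 3 ℤ.* + m) (expand (+ k) (+ n) (+ m)) ⟨
    ((+ k ℤ.* + n) ℤ.* + 1 ℤ.+ (ℤ.- + m) ℤ.* + 3) ℤ.* + 1 ℤ.+ + 3 ℤ.* + m ≤⟨ ℤₚ.+-monoˡ-≤ (+ 3 ℤ.* + m) h ⟩
    + s ℤ.* + 3 ℤ.+ + 3 ℤ.* + m                    ≡⟨ cong (ℤ._+ + 3 ℤ.* + m) (ℤₚ.*-comm (+ s) (+ 3)) ⟩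
    + 3 ℤ.* + s ℤ.+ + 3 ℤ.* + m                    ≡⟨ pos ⟨
    + (3 * s + 3 * m)                              ∎)
    where open ℤₚ.≤-Reasoning

fraction-≤⁻ : ∀ q n m → fromℕ m ℚ.≤ (+ 1 ℚ./ suc q) ℚ.* fromℕ n → suc q * m ≤ n
fraction-≤⁻ q n m (*≤* h) = ℤ.drop‿+≤+ (begin
  + (suc q * m)                   ≡⟨ cong +_ (*-comm (suc q) m) ⟩
  + (m * suc q)                   ≡⟨ cong (λ t → + (m * t)) (sym (*-identityʳ (suc q))) ⟩
  + (m * (suc q * 1))             ≡⟨ ℤₚ.pos-* m (suc q * 1) ⟩
  + m ℤ.* + (suc q * 1)           ≤⟨ h ⟩
  + 1 ℤ.* + n ℤ.* + 1             ≡⟨ trans (ℤₚ.*-identityʳ (+ 1 ℤ.* + n)) (ℤₚ.*-identityˡ (+ n)) ⟩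
  + n                             ∎)
  where open ℤₚ.≤-Reasoning

n≤3⌈n/3⌉ : ∀ n → n ≤ 3 * ⌈ n /3⌉
n≤3⌈n/3⌉ n = +-cancelˡ-≤ 2 _ _ (begin
  2 + n                         ≡⟨ +-comm 2 n ⟩
  n + 2                         ≡⟨ m≡m%n+[m/n]*n (n + 2) 3 ⟩
  (n + 2) % 3 + ⌈ n /3⌉ * 3     ≤⟨ +-mono-≤ (s≤s⁻¹ (m%n<n (n + 2) 3)) (≤-reflexive (*-comm ⌈ n /3⌉ 3)) ⟩
  2 + 3 * ⌈ n /3⌉               ∎)
  where
  open ≤-Reasoning

3⌈n/3⌉≤n+2 : ∀ n → 3 * ⌈ n /3⌉ ≤ n + 2
3⌈n/3⌉≤n+2 n = ≤-trans (≤-reflexive (*-comm 3 ⌈ n /3⌉)) (m/n*n≤m (n + 2) 3)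

⌈/3⌉-least : ∀ n m → n ≤ 3 * m → ⌈ n /3⌉ ≤ m
⌈/3⌉-least n m n≤3m = s≤s⁻¹ (m<n*o⇒m/o<n {n + 2} {suc m} {3} (begin-strict
  n + 2        ≡⟨ +-comm n 2 ⟩
  2 + n        <⟨ n<1+n (2 + n) ⟩
  3 + n        ≤⟨ +-monoʳ-≤ 3 n≤3m ⟩
  3 + 3 * m    ≡⟨ cong (λ t → 3 + t) (*-comm 3 m) ⟩
  suc m * 3    ∎))
  where
  open ≤-Reasoning

-- Numerical consequences of the size inequalities.

module Numbers (n c d f : ℕ) (n≤3c : n ≤ 3 * c) (3c≤n+2 : 3 * c ≤ n + 2) (c≡d+f : c ≡ d + f) (3000f≤n : 3000 * f ≤ n) where
  private
    ⟨n⟩ ⟨c⟩ ⟨d⟩ ⟨f⟩ : ∀ {k} → Lin (4 + k)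
    ⟨n⟩ = var (# 0)
    ⟨c⟩ = var (# 1)
    ⟨d⟩ = var (# 2)
    ⟨f⟩ = var (# 3)
    ⟨s⟩ ⟨i⟩ ⟨a⟩ : Lin 7
    ⟨s⟩ = var (# 4)
    ⟨i⟩ = var (# 5)
    ⟨a⟩ = var (# 6)
    ⟨x⟩ ⟨y⟩ : Lin 6
    ⟨x⟩ = var (# 4)
    ⟨y⟩ = var (# 5)

  -- `1000 d ≥ 1000 n / 3 − 1000 f`, and `1000 f ≤ n / 3`: the factor 3000 is chosen to give 333.
  333n≤1000d : 333 * n ≤ 1000 * d
  333n≤1000d = linear (n ∷ c ∷ d ∷ f ∷ [])
    ( 1000 · ⟨n⟩ ≼ 3 ⊛ ⟨c⟩ by n≤3c
    ∷ 3000 · ⟨c⟩ ≼ ⟨d⟩ ⊕ ⟨f⟩ by ≤-reflexive c≡d+f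
    ∷ 1 · 3000 ⊛ ⟨f⟩ ≼ ⟨n⟩ by 3000f≤n
    ∷ []) 2 (333 ⊛ ⟨n⟩) (1000 ⊛ ⟨d⟩)

  -- Rounding leaves `12 d ≤ 4 n + 8`, which is below `5 n` from `n = 9` on.
  12d<5n : 9 ≤ n → 12 * d < 5 * n
  12d<5n 9≤n = linear (n ∷ c ∷ d ∷ f ∷ [])
    ( 4 · 3 ⊛ ⟨c⟩ ≼ ⟨n⟩ ⊕ con 2 by 3c≤n+2
    ∷ 12 · ⟨d⟩ ⊕ ⟨f⟩ ≼ ⟨c⟩ by ≤-reflexive (sym c≡d+f)
    ∷ 1 · con 9 ≼ ⟨n⟩ by 9≤n
    ∷ []) 0 (con 1 ⊕ 12 ⊛ ⟨d⟩) (5 ⊛ ⟨n⟩)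

  44f<c : 1 ≤ f → 44 * f < c
  44f<c 1≤f = linear (n ∷ c ∷ d ∷ f ∷ [])
    ( 1 · ⟨n⟩ ≼ 3 ⊛ ⟨c⟩ by n≤3c
    ∷ 1 · 3000 ⊛ ⟨f⟩ ≼ ⟨n⟩ by 3000f≤n
    ∷ 3 · con 1 ≼ ⟨f⟩ by 1≤f
    ∷ []) 2 (con 1 ⊕ 44 ⊛ ⟨f⟩) ⟨c⟩

  module _ (s i a : ℕ) (n≡ : s + i + a ≡ n) (8d≤ : 8 * d ≤ 4 * s + a) (5d≤ : 5 * d ≤ 5 * i + 3 * a) where
    private
      ρ : Vec ℕ 7
      ρ = n ∷ c ∷ d ∷ f ∷ s ∷ i ∷ a ∷ []

    -- The combination gives `60 d + 3 a ≤ 20 n ≤ 60 (d + f)`. With `j` edges in place of four, the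
    -- coefficient of `a` would be proportional to `2 j − 5`.
    a≤20f : a ≤ 20 * f
    a≤20f = linear ρ
      ( 5 · 8 ⊛ ⟨d⟩ ≼ 4 ⊛ ⟨s⟩ ⊕ ⟨a⟩ by 8d≤
      ∷ 4 · 5 ⊛ ⟨d⟩ ≼ 5 ⊛ ⟨i⟩ ⊕ 3 ⊛ ⟨a⟩ by 5d≤
      ∷ 20 · ⟨s⟩ ⊕ ⟨i⟩ ⊕ ⟨a⟩ ≼ ⟨n⟩ by ≤-reflexive n≡
      ∷ 20 · ⟨n⟩ ≼ 3 ⊛ ⟨c⟩ by n≤3c
      ∷ 60 · ⟨c⟩ ≼ ⟨d⟩ ⊕ ⟨f⟩ by ≤-reflexive c≡d+f
      ∷ []) 2 ⟨a⟩ (20 ⊛ ⟨f⟩)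

    -- Here `s ≥ 2 d − 5 f`, so even `3 s ≥ 2 n − 21 f`.
    2n≤3s+27f : 2 * n ≤ 3 * s + 3 * (9 * f)
    2n≤3s+27f = linear ρ
      ( 3 · 8 ⊛ ⟨d⟩ ≼ 4 ⊛ ⟨s⟩ ⊕ ⟨a⟩ by 8d≤
      ∷ 3 · ⟨a⟩ ≼ 20 ⊛ ⟨f⟩ by a≤20f
      ∷ 8 · ⟨n⟩ ≼ 3 ⊛ ⟨c⟩ by n≤3c
      ∷ 24 · ⟨c⟩ ≼ ⟨d⟩ ⊕ ⟨f⟩ by ≤-reflexive c≡d+f
      ∷ []) 3 (2 ⊛ ⟨n⟩) (3 ⊛ ⟨s⟩ ⊕ 3 ⊛ (9 ⊛ ⟨f⟩))

    -- Here `i ≥ d − 12 f`, so even `3 i ≥ n − 39 f`.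
    n≤3i+72f : 1 * n ≤ 3 * i + 3 * (24 * f)
    n≤3i+72f = linear ρ
      ( 3 · 5 ⊛ ⟨d⟩ ≼ 5 ⊛ ⟨i⟩ ⊕ 3 ⊛ ⟨a⟩ by 5d≤
      ∷ 9 · ⟨a⟩ ≼ 20 ⊛ ⟨f⟩ by a≤20f
      ∷ 5 · ⟨n⟩ ≼ 3 ⊛ ⟨c⟩ by n≤3c
      ∷ 15 · ⟨c⟩ ≼ ⟨d⟩ ⊕ ⟨f⟩ by ≤-reflexive c≡d+f
      ∷ []) 4 (1 ⊛ ⟨n⟩) (3 ⊛ ⟨i⟩ ⊕ 3 ⊛ (24 ⊛ ⟨f⟩))

  -- `e ≥ d − a ≥ c − 21 f`; this lets each vertex of `A` choose its subset.
  kneser-size : ∀ {a e} → a ≤ 20 * f → d ≤ e + a → c ∸ 44 * f ≤ e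
  kneser-size {a} {e} a≤ d≤ = m≤n+o⇒m∸n≤o c (44 * f) (linear (n ∷ c ∷ d ∷ f ∷ a ∷ e ∷ [])
    ( 1 · ⟨x⟩ ≼ 20 ⊛ ⟨f⟩ by a≤
    ∷ 1 · ⟨d⟩ ≼ ⟨y⟩ ⊕ ⟨x⟩ by d≤
    ∷ 1 · ⟨c⟩ ≼ ⟨d⟩ ⊕ ⟨f⟩ by ≤-reflexive c≡d+f
    ∷ []) 0 ⟨c⟩ (44 ⊛ ⟨f⟩ ⊕ ⟨y⟩))

  -- `s ≤ n − d ≤ 2 c + f`, whereas the ground set has at least `2 c + 9 f` points because 97 - 2 ·
  -- 44 = 9.
  kneser-ground : ∀ {s} → d + s ≤ n → s ≤ 2 * (c ∸ 44 * f) + 97 * f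
  kneser-ground {s} d+s≤n = linear (n ∷ c ∷ d ∷ f ∷ s ∷ c ∸ 44 * f ∷ [])
    ( 1 · ⟨d⟩ ⊕ ⟨x⟩ ≼ ⟨n⟩ by d+s≤n
    ∷ 1 · ⟨n⟩ ≼ 3 ⊛ ⟨c⟩ by n≤3c
    ∷ 1 · ⟨c⟩ ≼ ⟨d⟩ ⊕ ⟨f⟩ by ≤-reflexive c≡d+f
    ∷ 2 · ⟨c⟩ ≼ 44 ⊛ ⟨f⟩ ⊕ ⟨y⟩ by m≤n+m∸n c (44 * f)
    ∷ []) 0 ⟨x⟩ (2 ⊛ ⟨y⟩ ⊕ 97 ⊛ ⟨f⟩)

-- Assembling the partition and the homomorphism.

Decomposition : ∀ {n} → SimpleGraph (Fin n) → ℕ → ℕ → Set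
Decomposition {n} G F c =
  Σ[ I₁ ∈ Subset n ] Σ[ I₂ ∈ Subset n ] Σ[ A ∈ Subset n ]
    (IsPartition I₁ I₂ A ×
    Independent G I₁ ×
    Independent G I₂ ×
    ((+ 2 ℚ./ 3) ℚ.* fromℕ n ℚ.- fromℕ (9 * F)) ℚ.≤ fromℕ ∣ I₁ ∣ ×
    ((+ 1 ℚ./ 3) ℚ.* fromℕ n ℚ.- fromℕ (24 * F)) ℚ.≤ fromℕ ∣ I₂ ∣ ×
    Σ[ m>0 ∈ NonZero (c ∸ 44 * F) ] Σ[ k>0 ∈ NonZero (97 * F) ]
    Hom (G [ A ]) (KG (c ∸ 44 * F) (97 * F) {{m>0}} {{k>0}}))

module Decompose {n : ℕ} (G : SimpleGraph (Fin n)) (triangle-free : TriangleFree G)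
                 (c d F : ℕ) (n≤3c : n ≤ 3 * c) (3c≤n+2 : 3 * c ≤ n + 2) (c≡d+F : c ≡ d + F)
                 (1≤F : 1 ≤ F) (3000F≤n : 3000 * F ≤ n)
                 (d≤deg : ∀ v → d ≤ degree G v) (333n≤1000d : 333 * n ≤ 1000 * d)
                 (b : Fin n) (560n≤deg : 560 * n ≤ 1000 * degree G b)
                 (l : ℕ) (χ≥ : ∀ k → Colorable G k → l ≤ k) (27<l : 27 < l) where

  open Structure G triangle-free d d≤deg 333n≤1000d b 560n≤deg
  open Sizes G triangle-free d d≤deg 333n≤1000d b 560n≤deg l χ≥ 27<l
  open Numbers n c d F n≤3c 3c≤n+2 c≡d+F 3000F≤n hiding (333n≤1000d)

  m : ℕ
  m = c ∸ 44 * F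

  partition : IsPartition P I₂ A
  partition = ⊆-antisym ⊆⊤ covers , disjoint-PI , disjoint-PA , disjoint-IA
    where
    covers : ∀ {x} → x ∈ ⊤ → x ∈ P ∪ I₂ ∪ A
    covers {x} _ with classify x
    ... | inP x∈P = x∈p∪q⁺ (inj₁ (∈P⁺ x∈P))
    ... | heavy h = x∈p∪q⁺ (inj₂ (x∈p∪q⁺ (inj₁ (∈I₂⁺ h))))
    ... | light h = x∈p∪q⁺ (inj₂ (x∈p∪q⁺ (inj₂ (∈A⁺ h))))
    disjoint-PI : Empty (P ∩ I₂)
    disjoint-PI (x , x∈) = let x∈P , x∈I₂ = x∈p∩q⁻ P I₂ x∈ in proj₁ (∈I₂⁻ x∈I₂) (∈P⁻ x∈P)
    disjoint-PA : Empty (P ∩ A)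
    disjoint-PA (x , x∈) = let x∈P , x∈A = x∈p∩q⁻ P A x∈ in proj₁ (∈A⁻ x∈A) (∈P⁻ x∈P)
    disjoint-IA : Empty (I₂ ∩ A)
    disjoint-IA (x , x∈) = let x∈I₂ , x∈A = x∈p∩q⁻ I₂ A x∈ in heavy⇒¬light (∈I₂⁻ x∈I₂) (∈A⁻ x∈A)

  I₁-independent : Independent G P
  I₁-independent u v u∈ v∈ = P-independent (∈P⁻ u∈) (∈P⁻ v∈)

  I₂-independent : Independent G I₂
  I₂-independent u v u∈ v∈ = heavy-isolated (∈I₂⁻ u∈) (proj₁ (∈I₂⁻ v∈))

  ∣A∣≤20F : ∣ A ∣ ≤ 20 * F
  ∣A∣≤20F = a≤20f (∣ P ∣) (∣ I₂ ∣) (∣ A ∣) partition-size 8d≤4∣P∣+∣A∣ 5d≤5∣I₂∣+3∣A∣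

  ∣P∣≤ground : ∣ P ∣ ≤ 2 * m + 97 * F
  -- Any one vertex of `P` has at least `d` neighbours, all outside `P`.
  ∣P∣≤ground = kneser-ground (≤-trans (+-monoˡ-≤ (∣ P ∣) (d≤deg _)) (deg+∣P∣≤n (∈P⁻ (proj₂ somewhere))))
    where
    somewhere : Nonempty P
    somewhere = 1≤∣∣⇒Nonempty P (positive-arith n (∣ P ∣) (Fin⇒1≤ b) 560n≤∣P∣)

  N∩P? : ∀ v w → Dec (Adj G v w × InP w)
  N∩P? v w = adj? G v w ×-dec inP? w

  m≤∣N∩P∣ : ∀ {v} → v ∈ A → m ≤ ∣ ⟪ N∩P? v ⟫ ∣
  m≤∣N∩P∣ {v} v∈A = ≤-trans
    (kneser-size ∣A∣≤20F (≤-trans (d≤deg v) (deg≤E+∣A∣ (∈A⁻ v∈A))))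
    (≤-reflexive (trans (E≡ v) (trans (sum-cong-≗ λ w → sym (𝟙-× (adj? G v w) (inP? w))) (sym (∣⟪⟫∣≡sum (N∩P? v))))))

  chosen : (v : Σ[ v ∈ Fin n ] v ∈ A) → ∃[ T ] (T ⊆ ⟪ N∩P? (proj₁ v) ⟫ × ∣ T ∣ ≡ m)
  chosen (v , v∈A) = subset-of-size m ⟪ N∩P? v ⟫ (m≤∣N∩P∣ v∈A)

  T : (v : Σ[ v ∈ Fin n ] v ∈ A) → Subset n
  T v = proj₁ (chosen v)

  T-adj : ∀ v {x} → x ∈ T v → Adj G (proj₁ v) x
  T-adj v x∈T = proj₁ (∈⟪⟫⁻ (N∩P? (proj₁ v)) (proj₁ (proj₂ (chosen v)) x∈T))

  T⊆P : ∀ v → T v ⊆ P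
  T⊆P v x∈T = ∈P⁺ (proj₂ (∈⟪⟫⁻ (N∩P? (proj₁ v)) (proj₁ (proj₂ (chosen v)) x∈T)))

  m≢0 : NonZero m
  m≢0 = >-nonZero (m<n⇒0<n∸m (44f<c 1≤F))

  97F≢0 : NonZero (97 * F)
  97F≢0 = m*n≢0 97 F {{_}} {{>-nonZero 1≤F}}

  hom : Hom (G [ A ]) (KG m (97 * F) {{m≢0}} {{97F≢0}})
  hom = record
    { map = λ v → compress P _ ∣P∣≤ground (T v) , trans (∣compress∣ P _ ∣P∣≤ground (T v) (T⊆P v)) (proj₂ (proj₂ (chosen v)))
    -- A point common to both images yields a common neighbour of the adjacent `u` and `v`, hence a
    -- triangle.
    ; map-edge = λ {u} {v} u~v (i , i∈) →
        let i∈u , i∈v = x∈p∩q⁻ _ _ i∈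
            x , x∈u , x∈v = ∈compress∩ P _ ∣P∣≤ground (T u) (T v) i∈u i∈v
        in triangle-free _ _ _ (u~v , T-adj v x∈v , T-adj u x∈u)
    }

  decomposition : Decomposition G F c
  decomposition = P , I₂ , A , partition , I₁-independent , I₂-independent ,
    thirds-≤⁺ 2 n (9 * F) (∣ P ∣) (2n≤3s+27f (∣ P ∣) (∣ I₂ ∣) (∣ A ∣) partition-size 8d≤4∣P∣+∣A∣ 5d≤5∣I₂∣+3∣A∣) ,
    thirds-≤⁺ 1 n (24 * F) (∣ I₂ ∣) (n≤3i+72f (∣ P ∣) (∣ I₂ ∣) (∣ A ∣) partition-size 8d≤4∣P∣+∣A∣ 5d≤5∣I₂∣+3∣A∣) ,
    m≢0 , 97F≢0 , hom

decompose : ∀ {n} (G : SimpleGraph (Fin n)) → TriangleFree G → ∀ c d F → n ≤ 3 * c → 3 * c ≤ n + 2 → c ≡ d + F →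
  1 ≤ F → 3000 * F ≤ n → 9 ≤ n → (∀ v → d ≤ degree G v) →
  ∀ l → (∀ k → Colorable G k → l ≤ k) → (∀ {j} → j ≤ 201 → 50 ^ j < l) → Decomposition G F c
decompose {n} G triangle-free c d F n≤3c 3c≤n+2 c≡d+F 1≤F 3000F≤n 9≤n d≤deg l χ≥ 50^<l
  with any? (λ b → 560 * n <? 1000 * degree G b)
-- The bound `27 < l` comes from `50 ^ 1 < l`.
... | yes (b , high) = Decompose.decomposition G triangle-free c d F n≤3c 3c≤n+2 c≡d+F 1≤F 3000F≤n d≤deg 333n≤1000d
                         b (<⇒≤ high) l χ≥ (<-trans (≤ᵇ⇒≤ 28 50 tt) (50^<l {1} (s≤s z≤n)))
  where open Numbers n c d F n≤3c 3c≤n+2 c≡d+F 3000F≤n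
... | no none = ⊥-elim (BoundedDegree.impossible G triangle-free d d≤deg {{>-nonZero (≤-trans (s≤s z≤n) 9≤n)}} (12d<5n 9≤n) 333n≤1000d l χ≥ 50^<l
                                    (λ v → ≮⇒≥ λ high → none (v , high)))
  where open Numbers n c d F n≤3c 3c≤n+2 c≡d+F 3000F≤n

module _ {n : ℕ} (G : SimpleGraph (Fin n)) (F : ℕ) (δ≥ : MinDegreeAtLeast G ((+ 1 ℚ./ 3) ℚ.* fromℕ n ℚ.- fromℕ F)) where

  -- Degrees are integers, so `n / 3` may be rounded up.
  degree-lower : ∀ v → ⌈ n /3⌉ ∸ F ≤ degree G v
  degree-lower v = m≤n+o⇒m∸n≤o ⌈ n /3⌉ F (⌈/3⌉-least n (F + degree G v) (begin
    n                          ≡⟨ *-identityˡ n ⟨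
    1 * n                      ≤⟨ thirds-≤⁻ 1 n F (degree G v) (δ≥ v) ⟩
    3 * degree G v + 3 * F     ≡⟨ *-distribˡ-+ 3 (degree G v) F ⟨
    3 * (degree G v + F)       ≡⟨ cong (3 *_) (+-comm (degree G v) F) ⟩
    3 * (F + degree G v)       ∎))
    where open ≤-Reasoning

small-excess : ∀ n F c → n ≤ 3 * c → 3000 * F ≤ n → F ≤ c
small-excess n F c n≤3c 3000F≤n = linear (n ∷ F ∷ c ∷ [])
  ( 1 · var (# 0) ≼ 3 ⊛ var (# 2) by n≤3c
  ∷ 1 · 3000 ⊛ var (# 1) ≼ var (# 0) by 3000F≤n
  ∷ []) 2 (var (# 1)) (var (# 2))

-- `50 ^ 201` is below `10 ^ 342`; the comparison is settled by evaluation.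
50^<10^391 : ∀ {j} → j ≤ 201 → 50 ^ j < 10 ^ 391
50^<10^391 j≤201 = ≤-<-trans (^-monoʳ-≤ 50 j≤201) (≤ᵇ⇒≤ _ _ tt)

theorem1p6 : ∀ (f : ℕ → ℕ) → (∀ n → NonZero n → NonZero (f n)) → f ∈o id →
    ∃[ N ] (∀ (n : ℕ) → N ≤ n →
    ∀ (G : SimpleGraph (Fin n)) → TriangleFree G →
    MinDegreeAtLeast G ((+ 1 ℚ./ 3) ℚ.* fromℕ n ℚ.- fromℕ (f n)) →
    ∀ (χ : ℕ) → IsChromaticNumber G χ → 10 ^ 391 ≤ χ →
    Σ[ I₁ ∈ Subset n ] Σ[ I₂ ∈ Subset n ] Σ[ A ∈ Subset n ]
    (IsPartition I₁ I₂ A ×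
    Independent G I₁ ×
    Independent G I₂ ×
    ((+ 2 ℚ./ 3) ℚ.* fromℕ n ℚ.- fromℕ (9 * f n)) ℚ.≤ fromℕ ∣ I₁ ∣ ×
    ((+ 1 ℚ./ 3) ℚ.* fromℕ n ℚ.- fromℕ (24 * f n)) ℚ.≤ fromℕ ∣ I₂ ∣ ×
    Σ[ m>0 ∈ NonZero (⌈ n /3⌉ ∸ 44 * f n) ] Σ[ k>0 ∈ NonZero (97 * f n) ]
    Hom (G [ A ]) (KG (⌈ n /3⌉ ∸ 44 * f n) (97 * f n) {{m>0}} {{k>0}})))
-- `N` is the threshold for `3000 * f n ≤ n`; the summand 9 absorbs rounding in `12d<5n` and makes
-- `n` positive.
theorem1p6 f f>0 f∈o = N + 9 , conclusion
  where
  0<1/3000 : ℚ.0ℚᵘ ℚ.< + 1 ℚ./ 3000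
  0<1/3000 = *<* (ℤ.+<+ (s≤s z≤n))
  N : ℕ
  N = proj₁ (f∈o (+ 1 ℚ./ 3000) 0<1/3000)
  conclusion : ∀ n → N + 9 ≤ n → ∀ (G : SimpleGraph (Fin n)) → TriangleFree G →
    MinDegreeAtLeast G ((+ 1 ℚ./ 3) ℚ.* fromℕ n ℚ.- fromℕ (f n)) →
    ∀ (χ : ℕ) → IsChromaticNumber G χ → 10 ^ 391 ≤ χ → Decomposition G (f n) ⌈ n /3⌉
  conclusion n N+9≤n G triangle-free δ≥ χ (_ , χ-least) 10^391≤χ =
    -- The degree bound `d` is `⌈ n /3⌉ ∸ f n`, and `small-excess` shows that this subtraction is
    -- not truncated.
    decompose G triangle-free ⌈ n /3⌉ (⌈ n /3⌉ ∸ f n) (f n) (n≤3⌈n/3⌉ n) (3⌈n/3⌉≤n+2 n)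
      (sym (m∸n+n≡m (small-excess n (f n) ⌈ n /3⌉ (n≤3⌈n/3⌉ n) 3000f≤n)))
      (>-nonZero⁻¹ (f n) {{f>0 n (>-nonZero (≤-trans (s≤s z≤n) 9≤n))}})
      3000f≤n 9≤n (degree-lower G (f n) δ≥) (10 ^ 391) (λ k col → ≤-trans 10^391≤χ (χ-least k col)) 50^<10^391
    where
    9≤n : 9 ≤ n
    9≤n = m+n≤o⇒n≤o N N+9≤n
    3000f≤n : 3000 * f n ≤ n
    3000f≤n = fraction-≤⁻ 2999 n (f n) (proj₂ (f∈o (+ 1 ℚ./ 3000) 0<1/3000) n (m+n≤o⇒m≤o N N+9≤n))
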